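{- Let $k,\ell\in \mathbb{N}_{\geq 2}$ be multiplicatively independent. Then the first-order theory $\mathrm{FO}(\mathbb{N},+,k^{\mathbb{N}},\ell^{\mathbb{N}})$ is undecidable.
   Context: $\mathbb{N}$ contains $0$. $k$ and $\ell$ are multiplicatively independent if $k^a\neq \ell^b$ for all nonzero $a,b\in\mathbb{Z}$. For $k\geq 2$, $k^{\mathbb{N}}=\{k^i: i\in\mathbb{N}\}$, viewed as a unary predicate. $\mathrm{FO}(\mathbb{N},+,k^{\mathbb{N}},\ell^{\mathbb{N}})$ denotes the set of first-order sentences true in the structure $(\mathbb{N},+,k^{\mathbb{N}},\ell^{\mathbb{N}})$. -}

module Defs where

open import Data.Nat using (ℕ; zero; suc; _+_; _*_; _^_; _<_)
open import Data.Fin using (Fin)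
open import Data.Vec using (Vec; []; _∷_; lookup)
open import Data.Product using (∃; Σ; _×_)
open import Data.Empty using (⊥)
open import Relation.Nullary using (¬_)
open import Relation.Binary.PropositionalEquality using (_≡_; _≢_)

-- Multiplicative independence.
-- k^a ≠ ℓ^b for all nonzero integers a, b.  For k, ℓ ≥ 2 the cases with
-- negative exponents reduce to (or are excluded by) the case a, b > 0,
-- so we state it over positive natural exponents.

MultIndep : ℕ → ℕ → Set
MultIndep k ℓ = ∀ (a b : ℕ) → a ≢ 0 → b ≢ 0 → k ^ a ≢ ℓ ^ b

PowOf : ℕ → ℕ → Set
PowOf k n = ∃ λ i → k ^ i ≡ n

-- First-order language {+, P₁, P₂} (with equality); variables are
-- de Bruijn indices.

data Term : Set where
  var  : ℕ → Term
  plus : Term → Term → Term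

data Formula : Set where
  eq   : Term → Term → Formula
  P₁   : Term → Formula
  P₂   : Term → Formula
  neg  : Formula → Formula
  conj : Formula → Formula → Formula
  ex   : Formula → Formula

Env : Set
Env = ℕ → ℕ

_∷ₑ_ : ℕ → Env → Env
(a ∷ₑ ρ) zero    = a
(a ∷ₑ ρ) (suc i) = ρ i

evalT : Env → Term → ℕ
evalT ρ (var i)    = ρ i
evalT ρ (plus s t) = evalT ρ s + evalT ρ t

Sat : ℕ → ℕ → Env → Formula → Set
Sat k ℓ ρ (eq s t)   = evalT ρ s ≡ evalT ρ t
Sat k ℓ ρ (P₁ t)     = PowOf k (evalT ρ t)
Sat k ℓ ρ (P₂ t)     = PowOf ℓ (evalT ρ t)
Sat k ℓ ρ (neg φ)    = ¬ Sat k ℓ ρ φ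
Sat k ℓ ρ (conj φ ψ) = Sat k ℓ ρ φ × Sat k ℓ ρ ψ
Sat k ℓ ρ (ex φ)     = Σ ℕ λ a → Sat k ℓ (a ∷ₑ ρ) φ

TermBounded : ℕ → Term → Set
TermBounded n (var i)    = i < n
TermBounded n (plus s t) = TermBounded n s × TermBounded n t

Bounded : ℕ → Formula → Set
Bounded n (eq s t)   = TermBounded n s × TermBounded n t
Bounded n (P₁ t)     = TermBounded n t
Bounded n (P₂ t)     = TermBounded n t
Bounded n (neg φ)    = Bounded n φ
Bounded n (conj φ ψ) = Bounded n φ × Bounded n ψ
Bounded n (ex φ)     = Bounded (suc n) φ

Sentence : Formula → Set
Sentence = Bounded 0

-- truth of a sentence (the environment is irrelevant for sentences)
True : ℕ → ℕ → Formula → Set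
True k ℓ φ = Sat k ℓ (λ _ → 0) φ

-- Gödel numbering via the Cantor pairing function.

tri : ℕ → ℕ
tri zero    = 0
tri (suc n) = suc n + tri n

pair : ℕ → ℕ → ℕ
pair a b = tri (a + b) + b

codeT : Term → ℕ
codeT (var i)    = pair 0 i
codeT (plus s t) = pair 1 (pair (codeT s) (codeT t))

code : Formula → ℕ
code (eq s t)   = pair 0 (pair (codeT s) (codeT t))
code (P₁ t)     = pair 1 (codeT t)
code (P₂ t)     = pair 2 (codeT t)
code (neg φ)    = pair 3 (code φ)
code (conj φ ψ) = pair 4 (pair (code φ) (code ψ))
code (ex φ)     = pair 5 (code φ)

data PR : ℕ → Set where
  zeroF : ∀ {n} → PR n
  succF : PR 1
  proj  : ∀ {n} → Fin n → PR n
  comp  : ∀ {m n} → PR m → Vec (PR n) m → PR n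
  prec  : ∀ {n} → PR n → PR (suc (suc n)) → PR (suc n)
  mu    : ∀ {n} → PR (suc n) → PR n

mutual
  data _⟦_⟧⇓_ : ∀ {n} → PR n → Vec ℕ n → ℕ → Set where
    zero⇓  : ∀ {n} {xs : Vec ℕ n} → zeroF ⟦ xs ⟧⇓ 0
    succ⇓  : ∀ {x} → succF ⟦ x ∷ [] ⟧⇓ suc x
    proj⇓  : ∀ {n} {i : Fin n} {xs} → proj i ⟦ xs ⟧⇓ lookup xs i
    comp⇓  : ∀ {m n} {f : PR m} {gs : Vec (PR n) m} {xs ys y} →
             gs ⟦ xs ⟧⇓* ys → f ⟦ ys ⟧⇓ y → comp f gs ⟦ xs ⟧⇓ y
    prec0⇓ : ∀ {n} {f : PR n} {g} {xs y} →
             f ⟦ xs ⟧⇓ y → prec f g ⟦ 0 ∷ xs ⟧⇓ y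
    precS⇓ : ∀ {n} {f : PR n} {g} {xs x r y} →
             prec f g ⟦ x ∷ xs ⟧⇓ r → g ⟦ x ∷ r ∷ xs ⟧⇓ y →
             prec f g ⟦ suc x ∷ xs ⟧⇓ y
    mu⇓    : ∀ {n} {f : PR (suc n)} {xs y} →
             f ⟦ y ∷ xs ⟧⇓ 0 →
             (∀ z → z < y → ∃ λ v → f ⟦ z ∷ xs ⟧⇓ suc v) →
             mu f ⟦ xs ⟧⇓ y

  data _⟦_⟧⇓*_ : ∀ {m n} → Vec (PR n) m → Vec ℕ n → Vec ℕ m → Set where
    []⇓  : ∀ {n} {xs : Vec ℕ n} → [] ⟦ xs ⟧⇓* []
    _∷⇓_ : ∀ {m n} {g : PR n} {gs : Vec (PR n) m} {xs y ys} →
           g ⟦ xs ⟧⇓ y → gs ⟦ xs ⟧⇓* ys → (g ∷ gs) ⟦ xs ⟧⇓* (y ∷ ys)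

TheoryDecidable : ℕ → ℕ → Set
TheoryDecidable k ℓ =
  ∃ λ (c : PR 1) → ∀ (φ : Formula) → Sentence φ →
    (True k ℓ φ → c ⟦ code φ ∷ [] ⟧⇓ 1) ×
    (¬ True k ℓ φ → c ⟦ code φ ∷ [] ⟧⇓ 0)

{-# OPTIONS --safe #-}

-- Fix w = k^p and call u = k^n marked if some power y of ℓ satisfies y ≤ u < y + w; the position
-- of u - y relative to w is then a digit s, with k^(p-s) ≤ u - y < 2 k^(p-s).  Whether k^(p+j) is
-- marked depends only on the slope ρ = ℓ^q / k^p, and slopes are dense because k and ℓ are
-- multiplicatively independent; nesting intervals of slopes, one finds p for which the consecutive
-- marked elements of some interval [lo, hi] carry any prescribed finite sequence of digits.  So a
-- sentence can quantify over finite tables of numbers, the number n being represented by the power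
-- x with k^(N+n) x = w, and in particular over tables of intermediate results of a computation.
-- A decision procedure for the theory would then contradict itself on the sentence asserting of
-- itself that the procedure rejects it.
module Submission where

open import Data.Empty using (⊥; ⊥-elim)
open import Data.Fin using (Fin; toℕ; _↑ʳ_) renaming (zero to fzero; suc to fsuc)
open import Data.Fin.Patterns
open import Data.List using (List; []; _∷_; _++_; length)
open import Data.List.Membership.Propositional using (_∈_)
open import Data.List.Membership.Propositional.Properties using (∈-++⁺ˡ; ∈-++⁺ʳ; ∈-++⁻)
open import Data.List.Properties using (∷-injective)
open import Data.List.Relation.Unary.All using (All; []; _∷_)
open import Data.List.Relation.Unary.Any using (here; there)
open import Data.Nat
open import Data.Nat.Properties
open import Data.Nat.Tactic.RingSolver using (solve-∀)
open import Data.Product hiding (swap)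
open import Data.Sum using (_⊎_; inj₁; inj₂)
open import Data.Unit using (⊤; tt)
open import Data.Vec using (Vec; []; _∷_; lookup)
open import Defs
open import Function using (_∘_)
open import Function.Bundles using (_⇔_; mk⇔; Equivalence)
open import Relation.Binary using (tri<; tri≈; tri>)
open import Relation.Binary.PropositionalEquality hiding (J)
open import Relation.Nullary using (¬_; yes; no; contradiction)
open import Relation.Nullary.Decidable using (_×-dec_; decidable-stable)
open import Relation.Unary using (Decidable)

open Equivalence using (to; from)
open ≤-Reasoning hiding (start)

-- Density of the quotients k^a / ℓ^b

-- Addition cannot express a computation directly, so its course has to be stored in the structure,
-- and the storage is the offset between almost coinciding powers of k and ℓ. An offset is read only
-- up to its order of magnitude: a digit then restricts the slope to an interval rather than to a
-- point, and further digits can be prescribed inside that interval. The obstacle is that no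
-- unwanted mark may slip in between two intended ones. The slopes at which ℓ^i marks k^j form an
-- interval of length 1 / ℓ^i with endpoints in ℤ / ℓ^i, so two such intervals are nested or
-- disjoint, and absence of a mark needs checking at a single slope only. Slopes k^J / ℓ^I are
-- suited for this, since k^J - ρ ℓ^I = 0 guarantees that some further mark exists. A stored table
-- is only required to be locally justified. It may therefore contain circular nonsense about
-- divergent computations; this is harmless because a decision procedure halts on every sentence.

n<b^n : ∀ {b} → 1 < b → ∀ n → n < b ^ n
n<b^n 1<b zero = z<s
n<b^n {b} 1<b (suc n) = begin-strict
  suc n        ≤⟨ n<b^n 1<b n ⟩
  b ^ n        <⟨ m<m*n (b ^ n) b {{m^n≢0 b n {{>-nonZero (<-trans z<s 1<b)}}}} 1<b ⟩
  b ^ n * b    ≡⟨ *-comm (b ^ n) b ⟩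
  b ^ suc n    ∎

bernoulli : ∀ v t → v ^ t * (v + t) ≤ suc v ^ t * v
bernoulli v zero = ≤-reflexive (cong (1 *_) (+-identityʳ v))
bernoulli v (suc t) = begin
  v * V * (v + suc t)                    ≤⟨ m≤m+n _ (V * t) ⟩
  v * V * (v + suc t) + V * t            ≡⟨ regroup v V t ⟩
  suc v * (V * (v + t))                  ≤⟨ *-monoʳ-≤ (suc v) (bernoulli v t) ⟩
  suc v * (U * v)                        ≡⟨ *-assoc (suc v) U v ⟨
  suc v * U * v                          ∎
  where
  V = v ^ t
  U = suc v ^ t
  regroup : ∀ v V t → v * V * (v + suc t) + V * t ≡ suc v * (V * (v + t))
  regroup = solve-∀

archimedes : ∀ {u v} → v < u → ∀ M → ∃ λ t → M * v ^ t < u ^ t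
archimedes {suc u} {zero} _ M = 1 , subst (_< suc u ^ 1) (sym (*-zeroʳ M)) (m^n>0 (suc u) 1)
archimedes {u} {v@(suc _)} v<u M = t , *-cancelʳ-< _ _ _ (begin-strict
  M * v ^ t * v             <⟨ m<m+n _ (m*n>0) ⟩
  M * v ^ t * v + v ^ t * v ≡⟨ regroup M (v ^ t) v ⟩
  v ^ t * (v + v * M)       ≤⟨ bernoulli v t ⟩
  suc v ^ t * v             ≤⟨ *-monoˡ-≤ v (^-monoˡ-≤ t v<u) ⟩
  u ^ t * v                 ∎)
  where
  -- For this t, Bernoulli's bound (1 + 1/v)^t ≥ 1 + t / v is 1 + M.
  t = v * M
  m*n>0 : 0 < v ^ t * v
  m*n>0 = *-mono-< (m^n>0 v t) z<s
  regroup : ∀ M V v → M * V * v + V * v ≡ V * (v + v * M)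
  regroup = solve-∀

crossing : ∀ {p} {P : ℕ → Set p} → Decidable P → ¬ P 0 → ∀ T → P T → ∃ λ t → ¬ P t × P (suc t)
crossing P? ¬P0 zero    P0 = contradiction P0 ¬P0
crossing P? ¬P0 (suc T) PT with P? T
... | yes p = crossing P? ¬P0 T p
... | no ¬p = T , ¬p , PT

module Density (k ℓ : ℕ) .{{_ : NonZero k}} .{{_ : NonZero ℓ}}
               (1<k : 1 < k) (1<ℓ : 1 < ℓ) (indep : MultIndep k ℓ) where

  k^≢0 : ∀ n → NonZero (k ^ n)
  k^≢0 n = m^n≢0 k n

  ℓ^≢0 : ∀ n → NonZero (ℓ ^ n)
  ℓ^≢0 n = m^n≢0 ℓ n

  -- 1 < k^a / ℓ^b < 1 + 1/N
  RatioClose : ℕ → ℕ → ℕ → Set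
  RatioClose N a b = ℓ ^ b < k ^ a × N * k ^ a < suc N * ℓ ^ b

  -- Dividing X / Y by a quotient C / D ≥ 1 + 1/N removes one factor 1 + 1/N from its upper bound; M
  -- / N′ stands for the remaining power of 1 + 1/N.
  shrink : ∀ X Y C D N N′ M → .{{NonZero D}} → X * (N * N′) < suc N * M * Y → suc N * D ≤ N * C →
           X * D * N′ < M * (Y * C)
  shrink X Y C D N N′ M lt le = *-cancelˡ-< (N * suc N) _ _ (begin-strict
    N * suc N * (X * D * N′)         ≡⟨ r₁ X D N N′ ⟩
    X * (N * N′) * (suc N * D)       <⟨ *-monoˡ-< (suc N * D) {{m*n≢0 (suc N) D}} lt ⟩
    suc N * M * Y * (suc N * D)      ≤⟨ *-monoʳ-≤ (suc N * M * Y) le ⟩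
    suc N * M * Y * (N * C)          ≡⟨ r₂ N M Y C ⟩
    N * suc N * (M * (Y * C))        ∎)
    where
    r₁ : ∀ X D N N′ → N * suc N * (X * D * N′) ≡ X * (N * N′) * (suc N * D)
    r₁ = solve-∀
    r₂ : ∀ N M Y C → suc N * M * Y * (N * C) ≡ N * suc N * (M * (Y * C))
    r₂ = solve-∀

  -- With x = k^a / ℓ^b and y = ℓ^c / k^d, take t with y^t < x ≤ y^(t+1). Then x / y^t lies in (1,
  -- y], so a small quotient y of the wrong orientation is traded for one with the power of k on
  -- top.
  divide : ∀ N a b c d → ℓ ^ b < k ^ a → k ^ d < ℓ ^ c → N * ℓ ^ c < suc N * k ^ d →
           ∃₂ (RatioClose N)
  divide N a b c d x>1 y>1 y-close =
    a + d * t , b + c * t , subst₂ _<_ (sym ℓ-pow) (sym k-pow) below ,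
    subst₂ (λ u v → N * u < suc N * v) (sym k-pow) (sym ℓ-pow) close
    where
    P : ℕ → Set
    P t = k ^ a * (k ^ d) ^ t ≤ ℓ ^ b * (ℓ ^ c) ^ t
    large : ∃ λ t → k ^ a * (k ^ d) ^ t < (ℓ ^ c) ^ t
    large = archimedes y>1 (k ^ a)
    cross : ∃ λ t → ¬ P t × P (suc t)
    cross = crossing (λ _ → _ ≤? _)
      (λ p → <⇒≱ x>1 (subst₂ _≤_ (*-identityʳ _) (*-identityʳ _) p)) (proj₁ large)
      (≤-trans (<⇒≤ (proj₂ large)) (m≤n*m _ (ℓ ^ b) {{ℓ^≢0 b}}))
    t = proj₁ cross
    X = k ^ a * (k ^ d) ^ t
    Y = ℓ ^ b * (ℓ ^ c) ^ t
    k-pow : k ^ (a + d * t) ≡ X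
    k-pow = trans (^-distribˡ-+-* k a (d * t)) (cong (k ^ a *_) (sym (^-*-assoc k d t)))
    ℓ-pow : ℓ ^ (b + c * t) ≡ Y
    ℓ-pow = trans (^-distribˡ-+-* ℓ b (c * t)) (cong (ℓ ^ b *_) (sym (^-*-assoc ℓ c t)))
    below : Y < X
    below = ≰⇒> (proj₁ (proj₂ cross))
    swap : ∀ p q r → p * (q * r) ≡ (p * r) * q
    swap = solve-∀
    move : ∀ M W U → M * W * U ≡ W * (M * U)
    move = solve-∀
    close : N * X < suc N * Y
    close = *-cancelʳ-< (k ^ d) _ _ (begin-strict
      N * X * k ^ d          ≡⟨ *-assoc N X (k ^ d) ⟩
      N * (X * k ^ d)        ≡⟨ cong (N *_) (swap (k ^ a) (k ^ d) ((k ^ d) ^ t)) ⟨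
      N * (k ^ a * (k ^ d) ^ suc t) ≤⟨ *-monoʳ-≤ N (proj₂ (proj₂ cross)) ⟩
      N * (ℓ ^ b * (ℓ ^ c) ^ suc t) ≡⟨ cong (N *_) (swap (ℓ ^ b) (ℓ ^ c) ((ℓ ^ c) ^ t)) ⟩
      N * (Y * ℓ ^ c)        ≡⟨ trans (sym (*-assoc N Y _)) (move N Y (ℓ ^ c)) ⟩
      Y * (N * ℓ ^ c)        <⟨ *-monoʳ-< Y {{m*n≢0 (ℓ ^ b) ((ℓ ^ c) ^ t) {{ℓ^≢0 b}} {{m^n≢0 (ℓ ^ c) t {{ℓ^≢0 c}}}}}} y-close ⟩
      Y * (suc N * k ^ d)    ≡⟨ move (suc N) Y (k ^ d) ⟨
      suc N * Y * k ^ d      ∎)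

  exponent≢0 : ∀ {v b} n → b < v ^ n → 0 < b → n ≢ 0
  exponent≢0 _ b<1 0<b refl = <⇒≱ b<1 0<b

  -- Subtractive Euclid on x = k^a / ℓ^b and y = ℓ^c / k^d: while both are at least 1 + 1/N,
  -- replacing the larger by the quotient lowers it by that factor, so the bounds
  -- x < (1 + 1/N)^n and y < (1 + 1/N)^m run out.
  euclid : ∀ N n m a b c d → ℓ ^ b < k ^ a → k ^ d < ℓ ^ c →
           k ^ a * N ^ n < suc N ^ n * ℓ ^ b → ℓ ^ c * N ^ m < suc N ^ m * k ^ d →
           ∃₂ (RatioClose N)
  euclid N zero m a b c d x>1 y>1 x< y< =
    ⊥-elim (<-asym x>1 (subst₂ _<_ (*-identityʳ _) (*-identityˡ _) x<))
  euclid N (suc n) zero a b c d x>1 y>1 x< y< =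
    ⊥-elim (<-asym y>1 (subst₂ _<_ (*-identityʳ _) (*-identityˡ _) y<))
  euclid N (suc n) (suc m) a b c d x>1 y>1 x< y< with N * k ^ a <? suc N * ℓ ^ b
  ... | yes x-close = a , b , x>1 , x-close
  ... | no x-far with N * ℓ ^ c <? suc N * k ^ d
  ... | yes y-close = divide N a b c d x>1 y>1 y-close
  ... | no y-far with <-cmp (k ^ (a + d)) (ℓ ^ (b + c))
  -- Independence enters here: x = y means k^(a+d) = ℓ^(b+c), and x, y > 1 force a and c to be
  -- nonzero.
  ... | tri≈ _ e≡ _ = ⊥-elim (indep (a + d) (b + c)
          (λ a+d≡0 → exponent≢0 a x>1 (m^n>0 ℓ b) (m+n≡0⇒m≡0 a a+d≡0))
          (λ b+c≡0 → exponent≢0 c y>1 (m^n>0 k d) (m+n≡0⇒n≡0 b b+c≡0)) e≡)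
  ... | tri> _ _ x>y = euclid N n (suc m) (a + d) (b + c) c d x>y y>1
          (subst₂ (λ u v → u * N ^ n < suc N ^ n * v)
            (sym (^-distribˡ-+-* k a d)) (sym (^-distribˡ-+-* ℓ b c))
            (shrink (k ^ a) (ℓ ^ b) (ℓ ^ c) (k ^ d) N (N ^ n) (suc N ^ n) {{k^≢0 d}} x< (≮⇒≥ y-far))) y<
  ... | tri< y>x _ _ = euclid N (suc n) m a b (c + b) (d + a) x>1
          (subst₂ _<_ (cong (k ^_) (+-comm a d)) (cong (ℓ ^_) (+-comm b c)) y>x) x<
          (subst₂ (λ u v → u * N ^ m < suc N ^ m * v)
            (sym (^-distribˡ-+-* ℓ c b)) (sym (^-distribˡ-+-* k d a))
            (shrink (ℓ ^ c) (k ^ d) (k ^ a) (ℓ ^ b) N (N ^ m) (suc N ^ m) {{ℓ^≢0 b}} y< (≮⇒≥ x-far)))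

  ratio-close : ∀ N → ∃₂ (RatioClose N)
  ratio-close N = euclid N (proj₁ n) (proj₁ m) 1 0 1 0
    (subst (1 <_) (sym (^-identityʳ k)) 1<k) (subst (1 <_) (sym (^-identityʳ ℓ)) 1<ℓ)
    (subst₂ _<_ (cong (_* N ^ proj₁ n) (sym (^-identityʳ k))) (sym (*-identityʳ _)) (proj₂ n))
    (subst₂ _<_ (cong (_* N ^ proj₁ m) (sym (^-identityʳ ℓ))) (sym (*-identityʳ _)) (proj₂ m))
    where
    n : ∃ λ t → k * N ^ t < suc N ^ t
    n = archimedes ≤-refl k
    m : ∃ λ t → ℓ * N ^ t < suc N ^ t
    m = archimedes ≤-refl ℓ

  -- Start at or below A / B and multiply by a quotient between 1 and 1 + 1/N until A / B is passed.
  -- The overshoot stays below (1 + 1/N) A / B, and for N = A D this is (A D + 1) / (B D) ≤ C / D.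
  density : ∀ A B C D → 0 < A → 0 < D → A * D < C * B → ∀ T →
            ∃₂ λ J I → T ≤ J × A * ℓ ^ I < k ^ J * B × k ^ J * D < C * ℓ ^ I
  density A B C D 0<A 0<D AD<CB T =
    T + a * suc t , I₀ + b * suc t , m≤m+n T _ ,
    subst₂ (λ u v → A * u < v * B) (sym ℓ-pow) (sym k-pow) (proj₂ (proj₂ cross)) ,
    subst₂ (λ u v → u * D < C * v) (sym k-pow) (sym ℓ-pow) above
    where
    N = A * D
    0<B : 0 < B
    0<B = n≢0⇒n>0 λ { refl → n≮0 (subst (N <_) (*-zeroʳ C) AD<CB) }
    ratio = ratio-close N
    a = proj₁ ratio
    b = proj₁ (proj₂ ratio)
    U = k ^ a
    V = ℓ ^ b
    -- ℓ^I₀ exceeds k^T B, which puts the starting value k^T / ℓ^I₀ at or below A / B.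
    I₀ = k ^ T * B
    P : ℕ → Set
    P t = A * (ℓ ^ I₀ * V ^ t) < k ^ T * U ^ t * B
    large : ∃ λ t → A * ℓ ^ I₀ * V ^ t < U ^ t
    large = archimedes (proj₁ (proj₂ (proj₂ ratio))) (A * ℓ ^ I₀)
    start : ¬ P 0
    start p = <⇒≱ p (begin
      k ^ T * 1 * B    ≡⟨ cong (_* B) (*-identityʳ (k ^ T)) ⟩
      I₀               ≤⟨ <⇒≤ (n<b^n 1<ℓ I₀) ⟩
      ℓ ^ I₀           ≤⟨ m≤n*m (ℓ ^ I₀) A {{>-nonZero 0<A}} ⟩
      A * ℓ ^ I₀       ≡⟨ cong (A *_) (*-identityʳ (ℓ ^ I₀)) ⟨
      A * (ℓ ^ I₀ * 1) ∎)
    end : P (proj₁ large)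
    end = begin-strict
      A * (ℓ ^ I₀ * V ^ proj₁ large)  ≡⟨ *-assoc A (ℓ ^ I₀) _ ⟨
      A * ℓ ^ I₀ * V ^ proj₁ large    <⟨ proj₂ large ⟩
      U ^ proj₁ large                 ≤⟨ m≤n*m _ (k ^ T) {{k^≢0 T}} ⟩
      k ^ T * U ^ proj₁ large         ≤⟨ m≤m*n _ B {{>-nonZero 0<B}} ⟩
      k ^ T * U ^ proj₁ large * B     ∎
    cross : ∃ λ t → ¬ P t × P (suc t)
    cross = crossing (λ _ → _ <? _) start (proj₁ large) end
    t = proj₁ cross
    k-pow : k ^ (T + a * suc t) ≡ k ^ T * U ^ suc t
    k-pow = trans (^-distribˡ-+-* k T _) (cong (k ^ T *_) (sym (^-*-assoc k a (suc t))))
    ℓ-pow : ℓ ^ (I₀ + b * suc t) ≡ ℓ ^ I₀ * V ^ suc t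
    ℓ-pow = trans (^-distribˡ-+-* ℓ I₀ _) (cong (ℓ ^ I₀ *_) (sym (^-*-assoc ℓ b (suc t))))
    X = k ^ T * U ^ t
    Y = ℓ ^ I₀ * V ^ t
    r₁ : ∀ K U U′ N B D → N * B * (K * (U * U′) * D) ≡ (K * U′ * B) * (N * U * D)
    r₁ = solve-∀
    r₂ : ∀ A Y N U D → A * Y * (N * U * D) ≡ (A * Y * D) * (N * U)
    r₂ = solve-∀
    r₃ : ∀ A Y D N V → (A * Y * D) * (suc N * V) ≡ (A * D) * (Y * V) * suc N
    r₃ = solve-∀
    r₄ : ∀ N L V V′ C B → N * (L * V′ * V) * (C * B) ≡ N * B * (C * (L * (V * V′)))
    r₄ = solve-∀
    above : k ^ T * U ^ suc t * D < C * (ℓ ^ I₀ * V ^ suc t)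
    above = *-cancelˡ-< (N * B) _ _ (begin-strict
      N * B * (k ^ T * (U * U ^ t) * D)    ≡⟨ r₁ (k ^ T) U (U ^ t) N B D ⟩
      X * B * (N * U * D)                  ≤⟨ *-monoˡ-≤ (N * U * D) (≮⇒≥ (proj₁ (proj₂ cross))) ⟩
      A * Y * (N * U * D)                  ≡⟨ r₂ A Y N U D ⟩
      (A * Y * D) * (N * U)                <⟨ *-monoʳ-< (A * Y * D) {{>-nonZero 0<AYD}} (proj₂ (proj₂ (proj₂ ratio))) ⟩
      (A * Y * D) * (suc N * V)            ≡⟨ r₃ A Y D N V ⟩
      N * (Y * V) * suc N                  ≤⟨ *-monoʳ-≤ (N * (Y * V)) AD<CB ⟩
      N * (Y * V) * (C * B)                ≡⟨ r₄ N (ℓ ^ I₀) V (V ^ t) C B ⟩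
      N * B * (C * (ℓ ^ I₀ * (V * V ^ t))) ∎)
      where
      0<AYD : 0 < A * Y * D
      0<AYD = *-mono-< (*-mono-< 0<A (*-mono-< (m^n>0 ℓ I₀) (m^n>0 V {{ℓ^≢0 b}} t))) 0<D

-- Realising digit sequences

least : ∀ {p} {P : ℕ → Set p} → Decidable P → ∀ n → P n →
        ∃ λ m → P m × (∀ {i} → i < m → ¬ P i)
least {P = P} P? n Pn with search n
  where
  search : ∀ n → (∃ λ m → P m × (∀ {i} → i < m → ¬ P i)) ⊎ (∀ {i} → i < n → ¬ P i)
  search zero = inj₂ λ ()
  search (suc n) with search n | P? n
  ... | inj₁ found | _      = inj₁ found
  ... | inj₂ none  | yes Pn = inj₁ (n , Pn , none)
  ... | inj₂ none  | no ¬Pn = inj₂ λ {i} i<1+n Pi → case (m<1+n⇒m<n∨m≡n i<1+n) Pi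
    where
    case : ∀ {i} → i < n ⊎ i ≡ n → ¬ P i
    case (inj₁ i<n)  = none i<n
    case (inj₂ refl) = ¬Pn
... | inj₁ found = found
... | inj₂ none  = n , Pn , none

-- In the next two lemmas ρ = Q / L is a slope with 5/4 < W (K - ρ V) < 3/2 and
-- 0 ≤ K′ - ρ V F < 1; K and K′ stand for powers of k, and V and F for powers of ℓ.

narrow-lower : ∀ Q L W V K K′ F G → .{{_ : NonZero L}} → .{{_ : NonZero F}} →
               Q * (4 * W * V) + 5 * L < 4 * W * K * L →
               L * K′ < Q * (V * F) + L → K′ + G ≡ K * F → 4 ≤ G → F < W * G
narrow-lower Q L W V K K′ F G core zone sum 4≤G = *-cancelˡ-< 5 _ _ (begin-strict
  5 * F                <⟨ *-cancelˡ-< L _ _ (+-cancelˡ-< (4 * W * (Q * (V * F))) _ _ bound) ⟩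
  4 * W * (1 + G)      ≡⟨ r₁ W G ⟩
  W * 4 + 4 * (W * G)  ≤⟨ +-monoˡ-≤ (4 * (W * G)) (*-monoʳ-≤ W 4≤G) ⟩
  5 * (W * G)          ∎)
  where
  r₁ : ∀ W G → 4 * W * (1 + G) ≡ W * 4 + 4 * (W * G)
  r₁ = solve-∀
  r₂ : ∀ W Q V F L → 4 * W * (Q * (V * F)) + L * (5 * F) ≡ (Q * (4 * W * V) + 5 * L) * F
  r₂ = solve-∀
  r₃ : ∀ W K L F → 4 * W * K * L * F ≡ 4 * W * L * (K * F)
  r₃ = solve-∀
  r₄ : ∀ W L K′ G → 4 * W * L * (K′ + G) ≡ 4 * W * (L * K′) + 4 * W * L * G
  r₄ = solve-∀
  r₅ : ∀ W Z L G → 4 * W * (Z + L) + 4 * W * L * G ≡ 4 * W * Z + L * (4 * W * (1 + G))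
  r₅ = solve-∀
  bound : 4 * W * (Q * (V * F)) + L * (5 * F) < 4 * W * (Q * (V * F)) + L * (4 * W * (1 + G))
  bound = begin-strict
    4 * W * (Q * (V * F)) + L * (5 * F)        ≡⟨ r₂ W Q V F L ⟩
    (Q * (4 * W * V) + 5 * L) * F              <⟨ *-monoˡ-< F core ⟩
    4 * W * K * L * F                          ≡⟨ r₃ W K L F ⟩
    4 * W * L * (K * F)                        ≡⟨ cong (4 * W * L *_) sum ⟨
    4 * W * L * (K′ + G)                       ≡⟨ r₄ W L K′ G ⟩
    4 * W * (L * K′) + 4 * W * L * G           ≤⟨ +-monoˡ-≤ _ (*-monoʳ-≤ (4 * W) (<⇒≤ zone)) ⟩
    4 * W * (Q * (V * F) + L) + 4 * W * L * G  ≡⟨ r₅ W (Q * (V * F)) L G ⟩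
    4 * W * (Q * (V * F)) + L * (4 * W * (1 + G)) ∎

narrow-upper : ∀ Q L W V K K′ F G → .{{_ : NonZero L}} → .{{_ : NonZero F}} →
               4 * W * K * L < Q * (4 * W * V) + 6 * L →
               Q * (V * F) ≤ L * K′ → K′ + G ≡ K * F → 4 ≤ G → W * (1 + G) ≤ 2 * F
narrow-upper Q L W V K K′ F G core zone sum 4≤G = *-cancelˡ-≤ 16 (begin
  16 * (W * (1 + G))          ≡⟨ r₁ W G ⟩
  4 * (W * 4) + 16 * (W * G)  ≤⟨ +-monoˡ-≤ _ (*-monoʳ-≤ 4 (*-monoʳ-≤ W 4≤G)) ⟩
  4 * (W * G) + 16 * (W * G)  ≡⟨ r₂ W G ⟩
  5 * (4 * W * G)             ≤⟨ *-monoʳ-≤ 5 (<⇒≤ (*-cancelˡ-< L _ _ (+-cancelˡ-< (4 * W * (L * K′)) _ _ bound))) ⟩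
  5 * (6 * F)                 ≡⟨ *-assoc 5 6 F ⟨
  -- The constants meet here: 4 ≤ G gives 1 + G ≤ (5/4) G, and (5/4)(3/2) = 15/8 stays below 2, just
  -- as dividing 5/4 by 5/4 leaves the bound 1 in `narrow-lower`.
  30 * F                      ≤⟨ *-monoˡ-≤ F (m≤m+n 30 2) ⟩
  32 * F                      ≡⟨ *-assoc 16 2 F ⟩
  16 * (2 * F)                ∎)
  where
  r₁ : ∀ W G → 16 * (W * (1 + G)) ≡ 4 * (W * 4) + 16 * (W * G)
  r₁ = solve-∀
  r₂ : ∀ W G → 4 * (W * G) + 16 * (W * G) ≡ 5 * (4 * W * G)
  r₂ = solve-∀
  r₃ : ∀ W L K′ G → 4 * W * (L * K′) + L * (4 * W * G) ≡ 4 * W * L * (K′ + G)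
  r₃ = solve-∀
  r₄ : ∀ W L K F → 4 * W * L * (K * F) ≡ 4 * W * K * L * F
  r₄ = solve-∀
  r₅ : ∀ Q W V L F → (Q * (4 * W * V) + 6 * L) * F ≡ 4 * W * (Q * (V * F)) + L * (6 * F)
  r₅ = solve-∀
  bound : 4 * W * (L * K′) + L * (4 * W * G) < 4 * W * (L * K′) + L * (6 * F)
  bound = begin-strict
    4 * W * (L * K′) + L * (4 * W * G)     ≡⟨ r₃ W L K′ G ⟩
    4 * W * L * (K′ + G)                   ≡⟨ cong (4 * W * L *_) sum ⟩
    4 * W * L * (K * F)                    ≡⟨ r₄ W L K F ⟩
    4 * W * K * L * F                      <⟨ *-monoˡ-< F core ⟩
    (Q * (4 * W * V) + 6 * L) * F          ≡⟨ r₅ Q W V L F ⟩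
    4 * W * (Q * (V * F)) + L * (6 * F)    ≤⟨ +-monoˡ-≤ _ (*-monoʳ-≤ (4 * W) zone) ⟩
    4 * W * (L * K′) + L * (6 * F)         ∎

-- Here ρ = Y / (X W) is any slope marking K′, not the one that was constructed. Since (K - ρ V) F =
-- G + (K′ - ρ V F) lies in [G, G + 1), the bounds on G and F alone put W (K - ρ V) into [1, 2),
-- which is the digit.
digit-bounds : ∀ X W Y V F K K′ G → .{{_ : NonZero F}} →
               Y * (V * F) ≤ X * W * K′ → X * W * K′ < Y * (V * F) + X * W → K′ + G ≡ K * F →
               F < W * G → W * (1 + G) ≤ 2 * F →
               Y * V + X ≤ X * W * K × X * W * K < Y * V + (X + X)
digit-bounds X W Y V F K K′ G lo hi sum lower upper =
  *-cancelʳ-≤ _ _ F (begin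
    (Y * V + X) * F                 ≡⟨ r₁ Y V X F ⟩
    Y * (V * F) + X * F             ≤⟨ +-mono-≤ lo (*-monoʳ-≤ X (<⇒≤ lower)) ⟩
    X * W * K′ + X * (W * G)        ≡⟨ whole ⟩
    X * W * K * F                   ∎) ,
  *-cancelʳ-< F _ _ (begin-strict
    X * W * K * F                        ≡⟨ whole ⟨
    X * W * K′ + X * (W * G)             <⟨ +-monoˡ-< (X * (W * G)) hi ⟩
    Y * (V * F) + X * W + X * (W * G)    ≡⟨ r₃ (Y * (V * F)) X W G ⟩
    Y * (V * F) + X * (W * (1 + G))      ≤⟨ +-monoʳ-≤ (Y * (V * F)) (*-monoʳ-≤ X upper) ⟩
    Y * (V * F) + X * (2 * F)            ≡⟨ r₄ Y V F X ⟩
    (Y * V + (X + X)) * F                ∎)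
  where
  r₁ : ∀ Y V X F → (Y * V + X) * F ≡ Y * (V * F) + X * F
  r₁ = solve-∀
  r₂ : ∀ X W K′ G → X * W * K′ + X * (W * G) ≡ X * W * (K′ + G)
  r₂ = solve-∀
  r₃ : ∀ Z X W G → Z + X * W + X * (W * G) ≡ Z + X * (W * (1 + G))
  r₃ = solve-∀
  r₄ : ∀ Y V F X → Y * (V * F) + X * (2 * F) ≡ (Y * V + (X + X)) * F
  r₄ = solve-∀
  whole : X * W * K′ + X * (W * G) ≡ X * W * K * F
  whole = trans (r₂ X W K′ G) (trans (cong (X * W *_) sum) (sym (*-assoc (X * W) K F)))

-- The intervals 0 ≤ K - ρ V < 1 and 0 ≤ K₁ - ρ V₁ < 1 of slopes ρ have endpoints in
-- ℤ / (V₁ F) and the second has length 1 / (V₁ F), V = V₁ F, so meeting at Y / R puts it inside the first.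
laminar : ∀ Y R Q L V₁ F K K₁ → .{{_ : NonZero F}} →
          Y * (V₁ * F) ≤ R * K → R * K < Y * (V₁ * F) + R →
          Y * V₁ ≤ R * K₁ → R * K₁ < Y * V₁ + R →
          Q * (V₁ * F) ≤ L * K → L * K < Q * (V₁ * F) + L →
          Q * V₁ ≤ L * K₁ × L * K₁ < Q * V₁ + L
laminar Y R Q L V₁ F K K₁ lo hi lo₁ hi₁ loQ hiQ =
  *-cancelʳ-≤ _ _ F (begin
    Q * V₁ * F      ≡⟨ *-assoc Q V₁ F ⟩
    Q * (V₁ * F)    ≤⟨ loQ ⟩
    L * K           ≤⟨ *-monoʳ-≤ L K≤ ⟩
    L * (K₁ * F)    ≡⟨ *-assoc L K₁ F ⟨
    L * K₁ * F      ∎) ,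
  *-cancelʳ-< F _ _ (+-cancelʳ-< L _ _ (begin-strict
    L * K₁ * F + L           ≡⟨ r₂ L K₁ F ⟩
    L * suc (K₁ * F)         ≤⟨ *-monoʳ-≤ L K₁F< ⟩
    L * (K + F)              ≡⟨ *-distribˡ-+ L K F ⟩
    L * K + L * F            <⟨ +-monoˡ-< (L * F) hiQ ⟩
    Q * (V₁ * F) + L + L * F ≡⟨ r₃ Q V₁ F L ⟩
    (Q * V₁ + L) * F + L     ∎))
  where
  r₁ : ∀ Y V₁ R F → (Y * V₁ + R) * F ≡ Y * (V₁ * F) + R * F
  r₁ = solve-∀
  r₂ : ∀ L K₁ F → L * K₁ * F + L ≡ L * suc (K₁ * F)
  r₂ = solve-∀
  r₃ : ∀ Q V₁ F L → Q * (V₁ * F) + L + L * F ≡ (Q * V₁ + L) * F + L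
  r₃ = solve-∀
  K≤ : K ≤ K₁ * F
  K≤ = s≤s⁻¹ (*-cancelˡ-< R _ _ (begin-strict
    R * K                <⟨ hi ⟩
    Y * (V₁ * F) + R     ≡⟨ cong (_+ R) (*-assoc Y V₁ F) ⟨
    Y * V₁ * F + R       ≤⟨ +-monoˡ-≤ R (*-monoˡ-≤ F lo₁) ⟩
    R * K₁ * F + R       ≡⟨ r₂ R K₁ F ⟩
    R * suc (K₁ * F)     ∎))
  K₁F< : K₁ * F < K + F
  K₁F< = *-cancelˡ-< R _ _ (begin-strict
    R * (K₁ * F)           ≡⟨ *-assoc R K₁ F ⟨
    R * K₁ * F             <⟨ *-monoˡ-< F hi₁ ⟩
    (Y * V₁ + R) * F       ≡⟨ r₁ Y V₁ R F ⟩
    Y * (V₁ * F) + R * F   ≤⟨ +-monoˡ-≤ (R * F) lo ⟩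
    R * K + R * F          ≡⟨ *-distribˡ-+ R K F ⟨
    R * (K + F)            ∎)

module Realisation (k ℓ : ℕ) .{{_ : NonZero k}} .{{_ : NonZero ℓ}}
                   (1<k : 1 < k) (1<ℓ : 1 < ℓ) (indep : MultIndep k ℓ) where

  open Density k ℓ 1<k 1<ℓ indep

  -- Relative to w = k^p, the power ℓ^m marks k^n; with Digit, it gives k^n the digit s.
  Near : ℕ → ℕ → ℕ → Set
  Near p n m = ℓ ^ m ≤ k ^ n × k ^ n < ℓ ^ m + k ^ p

  Digit : ℕ → ℕ → ℕ → ℕ → Set
  Digit p s n m = ℓ ^ m + k ^ (p ∸ s) ≤ k ^ n × k ^ n < ℓ ^ m + (k ^ (p ∸ s) + k ^ (p ∸ s))

  Gap : ℕ → ℕ → ℕ → Set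
  Gap p n n′ = ∀ v m → n < v → v < n′ → ¬ Near p v m

  k^-reflects-< : ∀ {a b} → k ^ a < k ^ b → a < b
  k^-reflects-< {a} {b} lt = ≰⇒> λ b≤a → <⇒≱ lt (^-monoʳ-≤ k b≤a)

  double : ∀ n → k ^ n + k ^ n ≤ k ^ suc n
  double n = begin
    k ^ n + k ^ n  ≡⟨ cong (k ^ n +_) (+-identityʳ (k ^ n)) ⟨
    2 * k ^ n      ≤⟨ *-monoˡ-≤ (k ^ n) 1<k ⟩
    k ^ suc n      ∎

  4≤k^ : ∀ {j} → 2 ≤ j → 4 ≤ k ^ j
  4≤k^ {j} 2≤j = begin
    2 * 2        ≤⟨ *-mono-≤ 1<k 1<k ⟩
    k * k        ≡⟨ cong (k *_) (^-identityʳ k) ⟨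
    k ^ 2        ≤⟨ ^-monoʳ-≤ k 2≤j ⟩
    k ^ j        ∎

  -- A slope is chosen at which k^j has digit s, and (j′, i′) is the next mark for that slope. Every
  -- slope marking j′ by i′ then gives j the digit s and keeps the gap empty, so p and q can be left
  -- to later digits.
  module Step (j i s : ℕ) (2≤j : 2 ≤ j) where
    W = k ^ s
    V = ℓ ^ i
    K = k ^ j

    -- A < 4 W V ρ < A + 1 amounts to 5 < 4 W (K - ρ V) < 6.
    A : ℕ
    A = 4 * W * K ∸ 6

    6≤ : 6 ≤ 4 * W * K
    6≤ = begin
      6             ≤⟨ m≤m+n 6 10 ⟩
      4 * 1 * 4     ≤⟨ *-mono-≤ (*-monoʳ-≤ 4 (m^n>0 k s)) (4≤k^ 2≤j) ⟩
      4 * W * K     ∎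

    A+6 : A + 6 ≡ 4 * W * K
    A+6 = m∸n+n≡m 6≤

    -- The slope ρ = k^J / ℓ^I has k^s (k^j - ρ ℓ^i) between 5/4 and 3/2, well inside the digit s.
    abstract
      target : ∃₂ λ J I → suc j ≤ J × A * ℓ ^ I < k ^ J * (4 * W * V) × k ^ J * (4 * W * V) < suc A * ℓ ^ I
      target = density A (4 * W * V) (suc A) (4 * W * V) 0<A 0<D (*-monoˡ-< _ {{>-nonZero 0<D}} (n<1+n A)) (suc j)
        where
        0<A : 0 < A
        0<A = m<n⇒0<n∸m (begin-strict
          6             <⟨ m≤m+n 7 9 ⟩
          4 * 1 * 4     ≤⟨ *-mono-≤ (*-monoʳ-≤ 4 (m^n>0 k s)) (4≤k^ 2≤j) ⟩
          4 * W * K     ∎)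
        0<D : 0 < 4 * W * V
        0<D = *-mono-< (*-mono-< (z<s {3}) (m^n>0 k s)) (m^n>0 ℓ i)

    J = proj₁ target
    I = proj₁ (proj₂ target)
    Q = k ^ J
    L = ℓ ^ I

    instance
      L≢0 : NonZero L
      L≢0 = ℓ^≢0 I

    core-lower : Q * (4 * W * V) + 5 * L < 4 * W * K * L
    core-lower = begin-strict
      Q * (4 * W * V) + 5 * L   <⟨ +-monoˡ-< (5 * L) (proj₂ (proj₂ (proj₂ (proj₂ target)))) ⟩
      suc A * L + 5 * L         ≡⟨ r A L ⟩
      (A + 6) * L               ≡⟨ cong (_* L) A+6 ⟩
      4 * W * K * L             ∎
      where
      r : ∀ A L → suc A * L + 5 * L ≡ (A + 6) * L
      r = solve-∀

    core-upper : 4 * W * K * L < Q * (4 * W * V) + 6 * L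
    core-upper = begin-strict
      4 * W * K * L             ≡⟨ cong (_* L) A+6 ⟨
      (A + 6) * L               ≡⟨ *-distribʳ-+ L A 6 ⟩
      A * L + 6 * L             <⟨ +-monoˡ-< (6 * L) (proj₁ (proj₂ (proj₂ (proj₂ target)))) ⟩
      Q * (4 * W * V) + 6 * L   ∎

    below : Q * V < K * L
    below = *-cancelˡ-< (4 * W) _ _ (begin-strict
      4 * W * (Q * V)          ≡⟨ r₁ W Q V ⟩
      Q * (4 * W * V)          ≤⟨ m≤m+n _ (5 * L) ⟩
      Q * (4 * W * V) + 5 * L  <⟨ core-lower ⟩
      4 * W * K * L            ≡⟨ *-assoc (4 * W) K L ⟩
      4 * W * (K * L)          ∎)
      where
      r₁ : ∀ W Q V → 4 * W * (Q * V) ≡ Q * (4 * W * V)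
      r₁ = solve-∀

    -- The mark condition for the slope ρ = Q / L, namely 0 ≤ k^j′ - ρ ℓ^i′ < 1. The pair (J, I)
    -- satisfies it with difference 0, so a least hit above j exists and a bounded search finds it.
    Hit : ℕ → ℕ → Set
    Hit j′ i′ = Q * ℓ ^ i′ ≤ L * k ^ j′ × L * k ^ j′ < Q * ℓ ^ i′ + L

    Candidate : ℕ → Set
    Candidate j′ = j < j′ × ∃ λ i′ → i′ < suc I × Hit j′ i′

    candidate? : Decidable Candidate
    candidate? j′ = (j <? j′) ×-dec anyUpTo? (λ i′ → (_ ≤? _) ×-dec (_ <? _)) (suc I)

    -- Minimality of j′ and laminarity leave no mark strictly between j and j′.
    abstract
      first : ∃ λ j′ → Candidate j′ × (∀ {j″} → j″ < j′ → ¬ Candidate j″)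
      first = least candidate? J (proj₁ (proj₂ (proj₂ target)) , I , ≤-refl ,
        ≤-reflexive (*-comm Q L) ,
        subst (_< Q * L + L) (*-comm Q L) (m<m+n (Q * L) (m^n>0 ℓ I)))

    j′ = proj₁ first
    j<j′ : j < j′
    j<j′ = proj₁ (proj₁ (proj₂ first))
    i′ = proj₁ (proj₂ (proj₁ (proj₂ first)))
    i′≤I : i′ < suc I
    i′≤I = proj₁ (proj₂ (proj₂ (proj₁ (proj₂ first))))
    hit-lower : Q * ℓ ^ i′ ≤ L * k ^ j′
    hit-lower = proj₁ (proj₂ (proj₂ (proj₂ (proj₁ (proj₂ first)))))
    hit-upper : L * k ^ j′ < Q * ℓ ^ i′ + L
    hit-upper = proj₂ (proj₂ (proj₂ (proj₂ (proj₁ (proj₂ first)))))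

    i<i′ : i < i′
    i<i′ = ≰⇒> λ i′≤i → <⇒≱ j<j′ (≮⇒≥ λ j<j′ → <⇒≱ (*-cancelˡ-< L _ _ (begin-strict
      L * k ^ j′       <⟨ hit-upper ⟩
      Q * ℓ ^ i′ + L   ≤⟨ +-monoˡ-≤ L (*-monoʳ-≤ Q (^-monoʳ-≤ ℓ i′≤i)) ⟩
      Q * V + L        ≤⟨ +-monoˡ-≤ L (<⇒≤ below) ⟩
      K * L + L        ≡⟨ r K L ⟩
      L * suc K        ∎)) (^-monoʳ-< k 1<k j<j′))
      where
      r : ∀ K L → K * L + L ≡ L * suc K
      r = solve-∀

    e = j′ ∸ j
    f = i′ ∸ i
    F = ℓ ^ f
    K′ = k ^ j′

    instance
      F≢0 : NonZero F
      F≢0 = ℓ^≢0 f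

    K′-split : K′ ≡ K * k ^ e
    K′-split = trans (cong (k ^_) (sym (m+[n∸m]≡n (<⇒≤ j<j′)))) (^-distribˡ-+-* k j e)

    ℓ-split : ℓ ^ i′ ≡ V * F
    ℓ-split = trans (cong (ℓ ^_) (sym (m+[n∸m]≡n (<⇒≤ i<i′)))) (^-distribˡ-+-* ℓ i f)

    -- Equality contradicts independence. If k^e > F, then K′ ≥ K F + K is at least ρ V F + 1
    -- because ρ V < K, and K′ is no hit. The strict inequality yields G ≥ K ≥ 4, the room that the
    -- two narrowing lemmas require.
    k^e<F : k ^ e < F
    k^e<F with <-cmp (k ^ e) F
    ... | tri< lt _ _ = lt
    ... | tri≈ _ e≡ _ = ⊥-elim (indep e f (m<n⇒n≢0 (m<n⇒0<n∸m j<j′)) (m<n⇒n≢0 (m<n⇒0<n∸m i<i′)) e≡)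
    ... | tri> _ _ gt = ⊥-elim (<-asym below (*-cancelʳ-< F _ _ (+-cancelʳ-< L _ _ (begin-strict
      K * L * F + L            ≤⟨ +-monoʳ-≤ _ (m≤n*m L K {{k^≢0 j}}) ⟩
      K * L * F + K * L        ≡⟨ r K L F ⟩
      L * (K * suc F)          ≤⟨ *-monoʳ-≤ L (*-monoʳ-≤ K gt) ⟩
      L * (K * k ^ e)          ≡⟨ cong (L *_) K′-split ⟨
      L * K′                   <⟨ hit-upper ⟩
      Q * ℓ ^ i′ + L           ≡⟨ cong (λ z → Q * z + L) ℓ-split ⟩
      Q * (V * F) + L          ≡⟨ cong (_+ L) (*-assoc Q V F) ⟨
      Q * V * F + L            ∎))))
      where
      r : ∀ K L F → K * L * F + K * L ≡ L * (K * suc F)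
      r = solve-∀

    G = K * F ∸ K′

    K′+K≤ : K′ + K ≤ K * F
    K′+K≤ = begin
      K′ + K            ≡⟨ cong (_+ K) K′-split ⟩
      K * k ^ e + K     ≡⟨ +-comm (K * k ^ e) K ⟩
      K + K * k ^ e     ≡⟨ *-suc K (k ^ e) ⟨
      K * suc (k ^ e)   ≤⟨ *-monoʳ-≤ K k^e<F ⟩
      K * F             ∎

    K′+G : K′ + G ≡ K * F
    K′+G = m+[n∸m]≡n (≤-trans (m≤m+n K′ K) K′+K≤)

    4≤G : 4 ≤ G
    4≤G = ≤-trans (4≤k^ 2≤j) (+-cancelˡ-≤ K′ K G (≤-trans K′+K≤ (≤-reflexive (sym K′+G))))

    F<WG : F < W * G
    F<WG = narrow-lower Q L W V K K′ F G core-lower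
      (subst (λ z → L * K′ < Q * z + L) ℓ-split hit-upper) K′+G 4≤G

    W[1+G]≤2F : W * (1 + G) ≤ 2 * F
    W[1+G]≤2F = narrow-upper Q L W V K K′ F G core-upper
      (subst (λ z → Q * z ≤ L * K′) ℓ-split hit-lower) K′+G 4≤G

    module _ {p q} (near : Near p (p + j′) (q + i′)) where

      R = k ^ p
      Y = ℓ ^ q

      near-lower : Y * ℓ ^ i′ ≤ R * K′
      near-lower = subst₂ _≤_ (^-distribˡ-+-* ℓ q i′) (^-distribˡ-+-* k p j′) (proj₁ near)

      near-upper : R * K′ < Y * ℓ ^ i′ + R
      near-upper = subst₂ (λ u v → u < v + R) (^-distribˡ-+-* k p j′) (^-distribˡ-+-* ℓ q i′) (proj₂ near)

      digit : s ≤ p → Digit p s (p + j) (q + i)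
      digit s≤p = subst₂ (λ u v → v + X ≤ u × u < v + (X + X))
          (trans (cong (_* K) R-split) (sym (^-distribˡ-+-* k p j))) (sym (^-distribˡ-+-* ℓ q i))
          (digit-bounds X W Y V F K K′ G
            (subst₂ (λ u v → Y * u ≤ v * K′) ℓ-split (sym R-split) near-lower)
            (subst₂ (λ u v → v * K′ < Y * u + v) ℓ-split (sym R-split) near-upper)
            K′+G F<WG W[1+G]≤2F)
        where
        X = k ^ (p ∸ s)
        R-split : X * W ≡ R
        R-split = trans (sym (^-distribˡ-+-* k (p ∸ s) s)) (cong (k ^_) (m∸n+n≡m s≤p))

      gap : ℓ ^ (q + i) ≤ k ^ (p + j) → Gap p (p + j) (p + j′)
      gap lower v m p+j<v v<p+j′ (lo , hi) = proj₂ (proj₂ first) j″<j′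
          (j<j″ , i″ , <-trans i″<i′ i′≤I , hit″)
        where
        p≤v : p ≤ v
        p≤v = ≤-trans (m≤m+n p j) (<⇒≤ p+j<v)
        j″ = v ∸ p
        v≡ : p + j″ ≡ v
        v≡ = m+[n∸m]≡n p≤v
        j″<j′ : j″ < j′
        j″<j′ = +-cancelˡ-< p _ _ (subst (_< p + j′) (sym v≡) v<p+j′)
        j<j″ : j < j″
        j<j″ = +-cancelˡ-< p _ _ (subst (p + j <_) (sym v≡) p+j<v)
        -- Distinct powers of k from k^p on differ by at least w, so the powers of ℓ that mark them
        -- come in the same order.
        m> : q + i < m
        m> = ≰⇒> λ m≤ → <⇒≱ hi (begin
          ℓ ^ m + R                  ≤⟨ +-mono-≤ (≤-trans (^-monoʳ-≤ ℓ m≤) lower) (^-monoʳ-≤ k (m≤m+n p j)) ⟩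
          k ^ (p + j) + k ^ (p + j)  ≤⟨ double (p + j) ⟩
          k ^ suc (p + j)            ≤⟨ ^-monoʳ-≤ k p+j<v ⟩
          k ^ v                      ∎)
        m< : m < q + i′
        m< = ≰⇒> λ ≤m → <⇒≱ (proj₂ near) (begin
          ℓ ^ (q + i′) + R   ≤⟨ +-mono-≤ (^-monoʳ-≤ ℓ ≤m) (^-monoʳ-≤ k p≤v) ⟩
          ℓ ^ m + k ^ v      ≤⟨ +-monoˡ-≤ (k ^ v) lo ⟩
          k ^ v + k ^ v      ≤⟨ double v ⟩
          k ^ suc v          ≤⟨ ^-monoʳ-≤ k v<p+j′ ⟩
          k ^ (p + j′)       ∎)
        i″ = m ∸ q
        m≡ : q + i″ ≡ m
        m≡ = m+[n∸m]≡n (≤-trans (m≤m+n q i) (<⇒≤ m>))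
        i″<i′ : i″ < i′
        i″<i′ = +-cancelˡ-< q _ _ (subst (_< q + i′) (sym m≡) m<)
        f″ = i′ ∸ i″
        split″ : ℓ ^ i′ ≡ ℓ ^ i″ * ℓ ^ f″
        split″ = trans (cong (ℓ ^_) (sym (m+[n∸m]≡n (<⇒≤ i″<i′)))) (^-distribˡ-+-* ℓ i″ f″)
        kv : k ^ v ≡ R * k ^ j″
        kv = trans (cong (k ^_) (sym v≡)) (^-distribˡ-+-* k p j″)
        ℓm : ℓ ^ m ≡ Y * ℓ ^ i″
        ℓm = trans (cong (ℓ ^_) (sym m≡)) (^-distribˡ-+-* ℓ q i″)
        hit″ : Hit j″ i″
        hit″ = laminar Y R Q L (ℓ ^ i″) (ℓ ^ f″) K′ (k ^ j″) {{ℓ^≢0 f″}}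
          (subst (λ z → Y * z ≤ R * K′) split″ near-lower)
          (subst (λ z → R * K′ < Y * z + R) split″ near-upper)
          (subst₂ _≤_ ℓm kv lo) (subst₂ (λ a b → a < b + R) kv ℓm hi)
          (subst (λ z → Q * z ≤ L * K′) split″ hit-lower)
          (subst (λ z → L * K′ < Q * z + L) split″ hit-upper)

  digit⇒near : ∀ {p s n m} → 1 ≤ s → s ≤ p → Digit p s n m → Near p n m
  digit⇒near {p} {s} {n} {m} 1≤s s≤p (lo , hi) = ≤-trans (m≤m+n _ _) lo , (begin-strict
    k ^ n                                    <⟨ hi ⟩
    ℓ ^ m + (k ^ (p ∸ s) + k ^ (p ∸ s))      ≤⟨ +-monoʳ-≤ (ℓ ^ m) (double (p ∸ s)) ⟩
    ℓ ^ m + k ^ suc (p ∸ s)                  ≤⟨ +-monoʳ-≤ (ℓ ^ m) (^-monoʳ-≤ k below-p) ⟩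
    ℓ ^ m + k ^ p                            ∎)
    where
    below-p : suc (p ∸ s) ≤ p
    below-p = ∸-monoʳ-< 1≤s s≤p

  -- Consecutive marked exponents, starting at the given one and carrying the given digits.
  data Chain (p : ℕ) : ℕ → List ℕ → Set where
    end  : ∀ {n m s} → p + 2 ≤ n → 1 ≤ s → s ≤ p → Digit p s n m → Chain p n (s ∷ [])
    link : ∀ {n m s n′ s′ ss} → p + 2 ≤ n → 1 ≤ s → s ≤ p → Digit p s n m →
           n < n′ → Gap p n n′ → Chain p n′ (s′ ∷ ss) → Chain p n (s ∷ s′ ∷ ss)

  indep-sym : MultIndep ℓ k
  indep-sym a b a≢0 b≢0 e≡ = indep b a b≢0 a≢0 (sym e≡)

  module Reverse = Density ℓ k 1<ℓ 1<k indep-sym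

  -- No mark has to follow the last digit, so an actual slope ℓ^q / k^p can be taken; it comes from
  -- density with k and ℓ exchanged.
  realise-one : ∀ S s j i → s ≤ S → 2 ≤ j → ∃₂ λ p q → S ≤ p × Digit p s (p + j) (q + i)
  realise-one S s j i s≤S 2≤j = p , q , <⇒≤ S<p ,
      subst₂ (λ u v → v + X ≤ u × u < v + (X + X)) (sym (^-distribˡ-+-* k p j)) (sym (^-distribˡ-+-* ℓ q i))
        (*-cancelˡ-≤ W {{k^≢0 s}} lower , *-cancelˡ-< W _ _ upper)
    where
    W = k ^ s
    V = ℓ ^ i
    K = k ^ j
    -- A < W V ρ < A + 1 means 1 < W (K - ρ V) < 2, the range of the digit s.
    A = W * K ∸ 2
    C = suc A
    4≤WK : 4 ≤ W * K
    4≤WK = *-mono-≤ (m^n>0 k s) (4≤k^ 2≤j)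
    A+2 : A + 2 ≡ W * K
    A+2 = m∸n+n≡m (≤-trans (m≤m+n 2 2) 4≤WK)
    0<A : 0 < A
    0<A = m<n⇒0<n∸m (≤-trans (m≤m+n 3 1) 4≤WK)
    0<D : 0 < W * V
    0<D = *-mono-< (m^n>0 k s) (m^n>0 ℓ i)
    -- Forces p > S: a large q makes ℓ^q large, and the slope bound passes this on to k^p.
    T = C * k ^ S
    slope : ∃₂ λ q p → T ≤ q × A * k ^ p < ℓ ^ q * (W * V) × ℓ ^ q * (W * V) < C * k ^ p
    slope = Reverse.density A (W * V) C (W * V) 0<A 0<D (*-monoˡ-< _ {{>-nonZero 0<D}} (n<1+n A)) T
    q = proj₁ slope
    p = proj₁ (proj₂ slope)
    R = k ^ p
    Y = ℓ ^ q
    slope-lower : A * R < Y * (W * V)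
    slope-lower = proj₁ (proj₂ (proj₂ (proj₂ slope)))
    slope-upper : Y * (W * V) < C * R
    slope-upper = proj₂ (proj₂ (proj₂ (proj₂ slope)))
    S<p : S < p
    S<p = k^-reflects-< (*-cancelˡ-< C _ _ (begin-strict
      C * k ^ S      <⟨ n<b^n 1<ℓ T ⟩
      ℓ ^ T          ≤⟨ ^-monoʳ-≤ ℓ (proj₁ (proj₂ (proj₂ slope))) ⟩
      Y              ≤⟨ m≤m*n Y (W * V) {{>-nonZero 0<D}} ⟩
      Y * (W * V)    <⟨ slope-upper ⟩
      C * R          ∎))
    X = k ^ (p ∸ s)
    R-split : W * X ≡ R
    R-split = trans (sym (^-distribˡ-+-* k s (p ∸ s))) (cong (k ^_) (m+[n∸m]≡n (≤-trans s≤S (<⇒≤ S<p))))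
    r₁ : ∀ W Y V X → W * (Y * V + X) ≡ Y * (W * V) + W * X
    r₁ = solve-∀
    r₂ : ∀ A R → suc A * R + R ≡ (A + 2) * R
    r₂ = solve-∀
    r₃ : ∀ A R → (A + 2) * R ≡ A * R + (R + R)
    r₃ = solve-∀
    r₄ : ∀ W Y V X → Y * (W * V) + (W * X + W * X) ≡ W * (Y * V + (X + X))
    r₄ = solve-∀
    r₅ : ∀ W K R → W * (R * K) ≡ W * K * R
    r₅ = solve-∀
    lower : W * (Y * V + X) ≤ W * (R * K)
    lower = begin
      W * (Y * V + X)        ≡⟨ r₁ W Y V X ⟩
      Y * (W * V) + W * X    ≤⟨ +-mono-≤ (<⇒≤ slope-upper) (≤-reflexive R-split) ⟩
      C * R + R              ≡⟨ r₂ A R ⟩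
      (A + 2) * R            ≡⟨ cong (_* R) A+2 ⟩
      W * K * R              ≡⟨ r₅ W K R ⟨
      W * (R * K)            ∎
    upper : W * (R * K) < W * (Y * V + (X + X))
    upper = begin-strict
      W * (R * K)                       ≡⟨ r₅ W K R ⟩
      W * K * R                         ≡⟨ cong (_* R) A+2 ⟨
      (A + 2) * R                       ≡⟨ r₃ A R ⟩
      A * R + (R + R)                   <⟨ +-monoˡ-< (R + R) slope-lower ⟩
      Y * (W * V) + (R + R)             ≡⟨ cong (λ z → Y * (W * V) + (z + z)) R-split ⟨
      Y * (W * V) + (W * X + W * X)     ≡⟨ r₄ W Y V X ⟩
      W * (Y * V + (X + X))             ∎

  -- `Step` fixes (j′, i′) before p and q are known; the induction hypothesis for the remaining
  -- digits, started at (j′, i′), supplies p and q for which j′ is marked by i′, and this determines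
  -- the digit at j and the gap. The bound S ≤ p keeps every p ∸ s from being truncated.
  realise : ∀ S s ss → All (λ t → 1 ≤ t × t ≤ S) (s ∷ ss) → ∀ j i → 2 ≤ j →
            ∃₂ λ p q → S ≤ p × Digit p s (p + j) (q + i) × Chain p (p + j) (s ∷ ss)
  realise S s [] ((1≤s , s≤S) ∷ []) j i 2≤j =
    let p , q , S≤p , d = realise-one S s j i s≤S 2≤j
    in p , q , S≤p , d , end {m = q + i} (+-monoʳ-≤ p 2≤j) 1≤s (≤-trans s≤S S≤p) d
  realise S s (s′ ∷ ss) ((1≤s , s≤S) ∷ bounds@((1≤s′ , s′≤S) ∷ _)) j i 2≤j =
    let open Step j i s 2≤j
        p , q , S≤p , d′ , chain = realise S s′ ss bounds j′ i′ (≤-trans 2≤j (<⇒≤ j<j′))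
        near = digit⇒near {p} {s′} {p + j′} {q + i′} 1≤s′ (≤-trans s′≤S S≤p) d′
        d = digit {p} {q} near (≤-trans s≤S S≤p)
    in p , q , S≤p , d ,
       link {m = q + i} (+-monoʳ-≤ p 2≤j) 1≤s (≤-trans s≤S S≤p) d (+-monoʳ-< p j<j′)
            (gap {p} {q} near (≤-trans (m≤m+n _ _) (proj₁ d))) chain

-- Formulas about tables

lift : Term → Term
lift (var i)    = var (suc i)
lift (plus s t) = plus (lift s) (lift t)

leF ltF : Term → Term → Formula
leF s t = ex (eq (plus (lift s) (var 0)) (lift t))
ltF s t = neg (leF t s)

-- In the formulas below c, c + 1, c + 2 are the variables holding w, lo and hi.

memF : ℕ → ℕ → Formula
memF c u = conj (P₁ (var u)) (conj (leF (var (1 + c)) (var u)) (conj (leF (var u) (var (2 + c)))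
  (ex (conj (P₂ (var 0)) (conj (leF (var 0) (var (suc u))) (ltF (var (suc u)) (plus (var 0) (var (suc c)))))))))

nextF : ℕ → ℕ → ℕ → Formula
nextF c u v = conj (memF c u) (conj (memF c v) (conj (ltF (var u) (var v))
  (neg (ex (conj (memF (suc c) 0) (conj (ltF (var (suc u)) (var 0)) (ltF (var 0) (var (suc v)))))))))

-- The digit s is visible to the structure only as x = k^(p-s); the conjunct x + x ≤ w says that s
-- is positive.
valF : ℕ → ℕ → ℕ → Formula
valF c u x = conj (P₁ (var x)) (conj (leF (plus (var x) (var x)) (var c))
  (ex (conj (P₂ (var 0)) (conj (leF (plus (var 0) (var (suc x))) (var (suc u)))
    (ltF (var (suc u)) (plus (var 0) (plus (var (suc x)) (var (suc x)))))))))

rowF : ℕ → ℕ → ℕ → ℕ → ℕ → Formula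
rowF c z a b d = ex (ex (ex (ex (conj (nextF (4 + c) 3 2) (conj (nextF (4 + c) 2 1) (conj (nextF (4 + c) 1 0)
  (conj (valF (4 + c) 3 (4 + z)) (conj (valF (4 + c) 2 (4 + a))
  (conj (valF (4 + c) 1 (4 + b)) (valF (4 + c) 0 (4 + d)))))))))))

-- Multiplication by n + 1, as the language has no term for 0.
mulT : ℕ → Term → Term
mulT zero    t = t
mulT (suc n) t = plus t (mulT n t)

evalT-mulT : ∀ ρ n t → evalT ρ (mulT n t) ≡ suc n * evalT ρ t
evalT-mulT ρ zero    t = sym (+-identityʳ _)
evalT-mulT ρ (suc n) t = cong (evalT ρ t +_) (evalT-mulT ρ n t)

LE LT : ℕ → ℕ → Set
LE a b = Σ ℕ λ z → a + z ≡ b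
LT a b = ¬ LE b a

LE⇒≤ : ∀ {a b} → LE a b → a ≤ b
LE⇒≤ {a} (z , refl) = m≤m+n a z

≤⇒LE : ∀ {a b} → a ≤ b → LE a b
≤⇒LE a≤b = _ , m+[n∸m]≡n a≤b

LT⇒< : ∀ {a b} → LT a b → a < b
LT⇒< a<b = ≰⇒> λ b≤a → a<b (≤⇒LE b≤a)

<⇒LT : ∀ {a b} → a < b → LT a b
<⇒LT a<b b≤a = <⇒≱ a<b (LE⇒≤ b≤a)

-- Queries about tables and their translation

data Query : ℕ → Set where
  row             : ∀ {d} → ℕ → Fin d → Fin d → Fin d → Query d
  sucQ eqQ ltQ    : ∀ {d} → Fin d → Fin d → Query d
  zeroQ           : ∀ {d} → Fin d → Query d
  notQ            : ∀ {d} → Query d → Query d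
  andQ            : ∀ {d} → Query d → Query d → Query d
  exQ             : ∀ {d} → Query (suc d) → Query d

_∷ᶠ_ : ∀ {d} → ℕ → (Fin d → ℕ) → Fin (suc d) → ℕ
(n ∷ᶠ σ) fzero    = n
(n ∷ᶠ σ) (fsuc i) = σ i

-- The table T is left abstract, so that soundness of closed tables covers whatever table an
-- existential quantifier of the structure may provide.
module Query⟦⟧ (T : ℕ → ℕ → ℕ → ℕ → Set) (B : ℕ) where

  ⟦_⟧ : ∀ {d} → Query d → (Fin d → ℕ) → Set
  ⟦ row t i j l ⟧ σ = T t (σ i) (σ j) (σ l)
  ⟦ sucQ i j ⟧    σ = σ j ≡ suc (σ i)
  ⟦ eqQ i j ⟧     σ = σ i ≡ σ j
  ⟦ ltQ i j ⟧     σ = σ i < σ j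
  ⟦ zeroQ i ⟧     σ = σ i ≡ 0
  ⟦ notQ φ ⟧      σ = ¬ ⟦ φ ⟧ σ
  ⟦ andQ φ ψ ⟧    σ = ⟦ φ ⟧ σ × ⟦ ψ ⟧ σ
  ⟦ exQ φ ⟧       σ = Σ ℕ λ n → n ≤ B × ⟦ φ ⟧ (n ∷ᶠ σ)

module Scaling (k ℓ : ℕ) .{{_ : NonZero k}} where

  scaleT : ℕ → Term → Term
  scaleT zero    s = s
  scaleT (suc t) s = mulT (pred k) (scaleT t s)

  scaleF : ℕ → ℕ → ℕ → Formula
  scaleF t i j = eq (scaleT t (var i)) (var j)

  evalT-scaleT : ∀ ρ t s → evalT ρ (scaleT t s) ≡ k ^ t * evalT ρ s
  evalT-scaleT ρ zero    s = sym (*-identityˡ _)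
  evalT-scaleT ρ (suc t) s = begin-equality
    evalT ρ (mulT (pred k) (scaleT t s))   ≡⟨ evalT-mulT ρ (pred k) _ ⟩
    suc (pred k) * evalT ρ (scaleT t s)    ≡⟨ cong₂ _*_ (suc-pred k) (evalT-scaleT ρ t s) ⟩
    k * (k ^ t * evalT ρ s)                ≡⟨ *-assoc k (k ^ t) _ ⟨
    k * k ^ t * evalT ρ s                  ∎

  scale⇒ : ∀ {ρ} t i {j} → Sat k ℓ ρ (scaleF t i j) → k ^ t * ρ i ≡ ρ j
  scale⇒ {ρ} t i h = trans (sym (evalT-scaleT ρ t (var i))) h

  scale⇐ : ∀ {ρ} t i {j} → k ^ t * ρ i ≡ ρ j → Sat k ℓ ρ (scaleF t i j)
  scale⇐ {ρ} t i h = trans (evalT-scaleT ρ t (var i)) h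

module Translation (k ℓ : ℕ) .{{_ : NonZero k}} (1<k : 1 < k) (N : ℕ) where

  open Scaling k ℓ public

  numF : ℕ → ℕ → Formula
  numF c x = conj (P₁ (var x)) (ex (conj (scaleF N (suc x) 0) (leF (var 0) (var (suc c)))))

  translate : ∀ {d} → Query d → Formula
  translate {d} (row t i j l) =
    ex (conj (scaleF t 0 (suc d)) (rowF (suc d) 0 (suc (toℕ i)) (suc (toℕ j)) (suc (toℕ l))))
  translate (sucQ i j)     = scaleF 1 (toℕ j) (toℕ i)
  translate (eqQ i j)      = eq (var (toℕ i)) (var (toℕ j))
  translate (ltQ i j)      = ltF (var (toℕ j)) (var (toℕ i))
  translate {d} (zeroQ i)  = scaleF N (toℕ i) d
  translate (notQ φ)       = neg (translate φ)
  translate (andQ φ ψ)     = conj (translate φ) (translate ψ)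
  translate {d} (exQ φ)    = ex (conj (numF (suc d) 0) (translate φ))

  -- `Mem`, `Next`, `Val` and `Row` are what `Sat` computes to on the corresponding formulas, so in
  -- the `row` case of `translate-correct` the witness passes through unchanged.
  Mem : ℕ → ℕ → ℕ → ℕ → Set
  Mem w lo hi u = PowOf k u × LE lo u × LE u hi × Σ ℕ λ y → PowOf ℓ y × LE y u × LT u (y + w)

  Next : ℕ → ℕ → ℕ → ℕ → ℕ → Set
  Next w lo hi u v = Mem w lo hi u × Mem w lo hi v × LT u v × ¬ Σ ℕ λ x → Mem w lo hi x × LT u x × LT x v

  Val : ℕ → ℕ → ℕ → Set
  Val w u x = PowOf k x × LE (x + x) w × Σ ℕ λ y → PowOf ℓ y × LE (y + x) u × LT u (y + (x + x))

  Row : ℕ → ℕ → ℕ → ℕ → ℕ → ℕ → ℕ → Set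
  Row w lo hi z a b d = Σ ℕ λ u₀ → Σ ℕ λ u₁ → Σ ℕ λ u₂ → Σ ℕ λ u₃ →
    Next w lo hi u₀ u₁ × Next w lo hi u₁ u₂ × Next w lo hi u₂ u₃ ×
    Val w u₀ z × Val w u₁ a × Val w u₂ b × Val w u₃ d

  module Number (p : ℕ) (N≤p : N ≤ p) (lo hi : ℕ) where

    w = k ^ p
    B = p ∸ N

    -- The power belonging to digit N + n; the digits below N remain free for tags. The map is
    -- decreasing: the successor divides by k, and comparisons turn around.
    rep : ℕ → ℕ
    rep n = k ^ (B ∸ n)

    Table : ℕ → ℕ → ℕ → ℕ → Set
    Table t a b d = Σ ℕ λ z → k ^ t * z ≡ w × Row w lo hi z (rep a) (rep b) (rep d)

    open Query⟦⟧ Table B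

    rep-scale : ∀ {n} → n ≤ B → k ^ (N + n) * rep n ≡ w
    rep-scale {n} n≤B = begin-equality
      k ^ (N + n) * rep n      ≡⟨ ^-distribˡ-+-* k (N + n) (B ∸ n) ⟨
      k ^ (N + n + (B ∸ n))    ≡⟨ cong (k ^_) (trans (+-assoc N n _) (cong (N +_) (m+[n∸m]≡n n≤B))) ⟩
      k ^ (N + B)              ≡⟨ cong (k ^_) (m+[n∸m]≡n N≤p) ⟩
      w                        ∎

    k^-injective : ∀ {a b} → k ^ a ≡ k ^ b → a ≡ b
    k^-injective {a} {b} e≡ = ≤-antisym (≮⇒≥ λ b<a → <-irrefl (sym e≡) (^-monoʳ-< k 1<k b<a))
                                        (≮⇒≥ λ a<b → <-irrefl e≡ (^-monoʳ-< k 1<k a<b))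

    rep-injective : ∀ {m n} → m ≤ B → n ≤ B → rep m ≡ rep n → m ≡ n
    rep-injective m≤B n≤B e≡ = ∸-cancelˡ-≡ m≤B n≤B (k^-injective e≡)

    rep-unscale : ∀ {t n} → n ≤ B → k ^ (N + t) * rep n ≡ w → t ≡ n
    rep-unscale {t} {n} n≤B e≡ = +-cancelˡ-≡ N _ _ (k^-injective
      (*-cancelʳ-≡ _ _ (rep n) {{m^n≢0 k (B ∸ n)}} (trans e≡ (sym (rep-scale n≤B)))))

    number : ∀ {x} → PowOf k x → k ^ N * x ≤ w → ∃ λ n → n ≤ B × rep n ≡ x
    number (r , refl) le = B ∸ r , m∸n≤m B r , cong (k ^_) (m∸[m∸n]≡n r≤B)
      where
      N+r≤p : N + r ≤ p
      N+r≤p = ≮⇒≥ λ p< → <⇒≱ (^-monoʳ-< k 1<k p<) (≤-trans (≤-reflexive (^-distribˡ-+-* k N r)) le)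
      r≤B : r ≤ B
      r≤B = m+n≤o⇒m≤o∸n r (≤-trans (≤-reflexive (+-comm r N)) N+r≤p)

    scale-suc : ∀ {m n} → m ≤ B → n ≤ B → k ^ 1 * rep n ≡ rep m ⇔ n ≡ suc m
    scale-suc {m} {n} m≤B n≤B = mk⇔
      (λ e≡ → trans (sym (m+n∸n≡m n (B ∸ n) )) (counts (k^-injective (trans (^-distribˡ-+-* k 1 (B ∸ n)) e≡))))
      (λ { refl → trans (sym (^-distribˡ-+-* k 1 (B ∸ suc m))) (cong (k ^_) (sym (+-∸-assoc 1 n≤B))) })
      where
      counts : 1 + (B ∸ n) ≡ B ∸ m → n + (B ∸ n) ∸ (B ∸ n) ≡ suc m
      counts e≡ = begin-equality
        n + (B ∸ n) ∸ (B ∸ n)       ≡⟨ cong (_∸ (B ∸ n)) (trans (m+[n∸m]≡n n≤B) (sym (m+[n∸m]≡n m≤B))) ⟩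
        m + (B ∸ m) ∸ (B ∸ n)       ≡⟨ cong (λ x → m + x ∸ (B ∸ n)) e≡ ⟨
        m + suc (B ∸ n) ∸ (B ∸ n)   ≡⟨ cong (_∸ (B ∸ n)) (+-suc m (B ∸ n)) ⟩
        suc m + (B ∸ n) ∸ (B ∸ n)   ≡⟨ m+n∸n≡m (suc m) (B ∸ n) ⟩
        suc m                       ∎

    rep-< : ∀ {m n} → m ≤ B → n ≤ B → m < n ⇔ rep n < rep m
    rep-< {m} {n} m≤B n≤B = mk⇔
      (λ m<n → ^-monoʳ-< k 1<k (∸-monoʳ-< m<n n≤B))
      (λ lt → ≰⇒> λ n≤m → <⇒≱ lt (^-monoʳ-≤ k (∸-monoʳ-≤ B n≤m)))

    record Represents {d} (ρ : Env) (σ : Fin d → ℕ) : Set where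
      field
        w-eq  : ρ d ≡ w
        lo-eq : ρ (1 + d) ≡ lo
        hi-eq : ρ (2 + d) ≡ hi
        reps  : ∀ i → ρ (toℕ i) ≡ rep (σ i)
        small : ∀ i → σ i ≤ B

    extend : ∀ {d ρ} {σ : Fin d → ℕ} {n} → n ≤ B → Represents ρ σ → Represents (rep n ∷ₑ ρ) (n ∷ᶠ σ)
    extend n≤B r = record
      { w-eq = w-eq ; lo-eq = lo-eq ; hi-eq = hi-eq
      ; reps  = λ { fzero → refl ; (fsuc i) → reps i }
      ; small = λ { fzero → n≤B ; (fsuc i) → small i } }
      where open Represents r

    translate-correct : ∀ {d} (φ : Query d) {ρ σ} → Represents ρ σ → Sat k ℓ ρ (translate φ) ⇔ ⟦ φ ⟧ σ
    translate-correct {d} (row t i j l) {ρ} {σ} r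
      rewrite sym (Represents.reps r i) | sym (Represents.reps r j) | sym (Represents.reps r l)
            | sym (Represents.w-eq r) | sym (Represents.lo-eq r) | sym (Represents.hi-eq r) = mk⇔
      (λ { (z , s , h) → z , scale⇒ {z ∷ₑ ρ} t 0 {suc d} s , h })
      (λ { (z , s , h) → z , scale⇐ {z ∷ₑ ρ} t 0 {suc d} s , h })
    translate-correct (sucQ i j) {ρ} r = mk⇔
      (λ h → to suc⇔ (subst₂ (λ x y → k ^ 1 * x ≡ y) (reps j) (reps i) (scale⇒ {ρ} 1 (toℕ j) {toℕ i} h)))
      (λ h → scale⇐ {ρ} 1 (toℕ j) {toℕ i} (subst₂ (λ x y → k ^ 1 * x ≡ y) (sym (reps j)) (sym (reps i)) (from suc⇔ h)))
      where
      open Represents r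
      suc⇔ = scale-suc (small i) (small j)
    translate-correct (eqQ i j) r = mk⇔
      (λ h → rep-injective (small i) (small j) (trans (sym (reps i)) (trans h (reps j))))
      (λ h → trans (reps i) (trans (cong rep h) (sym (reps j))))
      where open Represents r
    translate-correct (ltQ i j) r = mk⇔
      (λ h → from lt⇔ (subst₂ _<_ (reps j) (reps i) (LT⇒< h)))
      (λ h → <⇒LT (subst₂ _<_ (sym (reps j)) (sym (reps i)) (to lt⇔ h)))
      where
      open Represents r
      lt⇔ = rep-< (small i) (small j)
    translate-correct {d} (zeroQ i) {ρ} {σ} r = mk⇔
      (λ h → sym (rep-unscale {0} (small i) (trans (cong (λ x → k ^ x * rep (σ i)) (+-identityʳ N))
               (subst₂ (λ x y → k ^ N * x ≡ y) (reps i) w-eq (scale⇒ {ρ} N (toℕ i) {d} h)))))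
      (λ h → scale⇐ {ρ} N (toℕ i) {d} (trans (cong (k ^ N *_) (trans (reps i) (cong rep h)))
               (trans (trans (cong (λ x → k ^ x * rep 0) (sym (+-identityʳ N))) (rep-scale z≤n)) (sym w-eq))))
      where open Represents r
    translate-correct (notQ φ) r = mk⇔ (λ h x → h (from ih x)) (λ h x → h (to ih x))
      where ih = translate-correct φ r
    translate-correct (andQ φ ψ) r = mk⇔ (map (to ihφ) (to ihψ)) (map (from ihφ) (from ihψ))
      where
      ihφ = translate-correct φ r
      ihψ = translate-correct ψ r
    translate-correct {d} (exQ φ) {ρ} {σ} r = mk⇔ forth back
      where
      open Represents r
      forth : Sat k ℓ ρ (translate (exQ φ)) → ⟦ exQ φ ⟧ σ
      forth (x , (pow , y , s , le) , h)
        with number pow (subst₂ _≤_ (sym (scale⇒ {y ∷ₑ (x ∷ₑ ρ)} N 1 {0} s)) w-eq (LE⇒≤ le))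
      ... | n , n≤B , refl = n , n≤B , to (translate-correct φ (extend n≤B r)) h
      back : ⟦ exQ φ ⟧ σ → Sat k ℓ ρ (translate (exQ φ))
      back (n , n≤B , h) = rep n , ((B ∸ n , refl) , k ^ N * rep n ,
          scale⇐ {(k ^ N * rep n) ∷ₑ (rep n ∷ₑ ρ)} N 1 {0} refl ,
          ≤⇒LE (≤-trans (*-monoˡ-≤ (rep n) (^-monoʳ-≤ k (m≤m+n N n))) (≤-reflexive (trans (rep-scale n≤B) (sym w-eq))))) ,
        from (translate-correct φ (extend n≤B r)) h

-- Windows of four consecutive marks

module Windows (k ℓ : ℕ) .{{_ : NonZero k}} .{{_ : NonZero ℓ}}
               (1<k : 1 < k) (1<ℓ : 1 < ℓ) (indep : MultIndep k ℓ) (N : ℕ) where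

  open Realisation k ℓ 1<k 1<ℓ indep
  open Translation k ℓ 1<k N

  module _ {p : ℕ} where

    last : ∀ {n ss} → Chain p n ss → ℕ
    last {n} (end _ _ _ _)      = n
    last (link _ _ _ _ _ _ c)   = last c

    head≤last : ∀ {n ss} (c : Chain p n ss) → n ≤ last c
    head≤last (end _ _ _ _)        = ≤-refl
    head≤last (link _ _ _ _ lt _ c) = ≤-trans (<⇒≤ lt) (head≤last c)

    head-near : ∀ {n ss} → Chain p n ss → ∃ λ m → Near p n m
    head-near {n} (end {m = m} {s} _ 1≤s s≤p d)        = m , digit⇒near {p} {s} {n} {m} 1≤s s≤p d
    head-near {n} (link {m = m} {s} _ 1≤s s≤p d _ _ _) = m , digit⇒near {p} {s} {n} {m} 1≤s s≤p d

    -- From m < m′ follows 2 ℓ^m ≤ ℓ^m′ ≤ k^n, and doubling k^n < ℓ^m + w gives k^n < 2 w. This is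
    -- impossible for p + 2 ≤ n, the reason for carrying that bound along a `Chain`.
    near-≮ : ∀ {n m m′} → p + 2 ≤ n → Near p n m → Near p n m′ → ¬ m < m′
    near-≮ {n} {m} {m′} high (_ , hi) (lo′ , _) m<m′ = <-irrefl refl (begin-strict
      k ^ n + k ^ n                          <⟨ +-mono-< hi hi ⟩
      ℓ ^ m + k ^ p + (ℓ ^ m + k ^ p)        ≡⟨ +-assoc-middle (ℓ ^ m) (k ^ p) ⟩
      ℓ ^ m + ℓ ^ m + (k ^ p + k ^ p)        ≤⟨ +-mono-≤ double-ℓ (double p) ⟩
      ℓ ^ suc m + k ^ suc p                  ≤⟨ +-mono-≤ (^-monoʳ-≤ ℓ m<m′) (^-monoʳ-≤ k (≤-trans (≤-reflexive (+-comm 1 p)) (+-monoʳ-≤ p (s≤s z≤n)))) ⟩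
      ℓ ^ m′ + k ^ (p + 2)                   ≤⟨ +-mono-≤ lo′ (^-monoʳ-≤ k high) ⟩
      k ^ n + k ^ n                          ∎)
      where
      +-assoc-middle : ∀ a b → a + b + (a + b) ≡ a + a + (b + b)
      +-assoc-middle a b = trans (+-assoc a b (a + b)) (trans (cong (a +_) (trans (sym (+-assoc b a b))
        (trans (cong (_+ b) (+-comm b a)) (+-assoc a b b)))) (sym (+-assoc a a (b + b))))
      double-ℓ : ℓ ^ m + ℓ ^ m ≤ ℓ ^ suc m
      double-ℓ = begin
        ℓ ^ m + ℓ ^ m  ≡⟨ cong (ℓ ^ m +_) (+-identityʳ (ℓ ^ m)) ⟨
        2 * ℓ ^ m      ≤⟨ *-monoˡ-≤ (ℓ ^ m) 1<ℓ ⟩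
        ℓ ^ suc m      ∎

    near-unique : ∀ {n m m′} → p + 2 ≤ n → Near p n m → Near p n m′ → m ≡ m′
    near-unique {n} {m} {m′} high a b with <-cmp m m′
    ... | tri< lt _ _ = ⊥-elim (near-≮ {n} {m} {m′} high a b lt)
    ... | tri≈ _ e _ = e
    ... | tri> _ _ gt = ⊥-elim (near-≮ {n} {m′} {m} high b a gt)

    digit-≮ : ∀ {n m s s′} → s′ ≤ p → Digit p s n m → Digit p s′ n m → ¬ s < s′
    digit-≮ {n} {m} {s} {s′} s′≤p (lo , _) (_ , hi′) s<s′ = <⇒≱ hi′ (begin
      ℓ ^ m + (k ^ (p ∸ s′) + k ^ (p ∸ s′))   ≤⟨ +-monoʳ-≤ (ℓ ^ m) (double (p ∸ s′)) ⟩
      ℓ ^ m + k ^ suc (p ∸ s′)                ≤⟨ +-monoʳ-≤ (ℓ ^ m) (^-monoʳ-≤ k (∸-monoʳ-< s<s′ s′≤p)) ⟩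
      ℓ ^ m + k ^ (p ∸ s)                     ≤⟨ lo ⟩
      k ^ n                                   ∎)

    digit-unique : ∀ {n m m′ s s′} → p + 2 ≤ n → 1 ≤ s → s ≤ p → 1 ≤ s′ → s′ ≤ p →
                   Digit p s n m → Digit p s′ n m′ → s ≡ s′
    digit-unique {n} {m} {m′} {s} {s′} high 1≤s s≤p 1≤s′ s′≤p a b
      with near-unique {n} {m} {m′} high (digit⇒near {p} {s} {n} {m} 1≤s s≤p a) (digit⇒near {p} {s′} {n} {m′} 1≤s′ s′≤p b)
    ... | refl with <-cmp s s′
    ... | tri< lt _ _ = ⊥-elim (digit-≮ {n} {m} s′≤p a b lt)
    ... | tri≈ _ e _ = e
    ... | tri> _ _ gt = ⊥-elim (digit-≮ {n} {m} s≤p b a gt)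

    gap-avoids-head : ∀ {n n′ v ss} → Gap p n n′ → Chain p v ss → n < v → ¬ v < n′
    gap-avoids-head {v = v} gap c n<v v<n′ = gap v (proj₁ (head-near c)) n<v v<n′ (proj₂ (head-near c))

    prefix : ∀ {n ss ts} (c : Chain p n ss) (d : Chain p n ts) → last d ≤ last c →
             ∃ λ post → ss ≡ ts ++ post
    prefix (end {m = m} h 1≤s s≤p a) (end {m = m′} _ 1≤t t≤p b) _ =
      [] , cong (_∷ []) (digit-unique {m = m} {m′} h 1≤s s≤p 1≤t t≤p a b)
    prefix (end _ _ _ _) (link _ _ _ _ lt _ d) le =
      ⊥-elim (<⇒≱ lt (≤-trans (head≤last d) le))
    prefix (link {m = m} {s′ = s′} {ss} h 1≤s s≤p a _ _ c) (end {m = m′} _ 1≤t t≤p b) _ =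
      s′ ∷ ss , cong (_∷ s′ ∷ ss) (digit-unique {m = m} {m′} h 1≤s s≤p 1≤t t≤p a b)
    prefix (link {m = m} {n′ = n′} h 1≤s s≤p a n<n′ gap c) (link {m = m′} {n′ = v} _ 1≤t t≤p b n<v gap′ d) le
      with <-cmp n′ v
    ... | tri< lt _ _ = ⊥-elim (gap-avoids-head gap′ c n<n′ lt)
    ... | tri> _ _ gt = ⊥-elim (gap-avoids-head gap d n<v gt)
    ... | tri≈ _ refl _ =
      map₂ (λ e → cong₂ _∷_ (digit-unique {m = m} {m′} h 1≤s s≤p 1≤t t≤p a b) e) (prefix c d le)

    -- Walking along c one meets the start of d, since no gap of c contains a marked exponent. From
    -- there on the chains visit the same exponents, each having no mark inside the gaps of the
    -- other, and digits are unique.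
    infix-of : ∀ {n v ss ts} (c : Chain p n ss) (d : Chain p v ts) → n ≤ v → last d ≤ last c →
               ∃₂ λ pre post → ss ≡ pre ++ ts ++ post
    infix-of {n} {v} c d n≤v le with <-cmp n v
    ... | tri> _ _ gt = ⊥-elim (<⇒≱ gt n≤v)
    ... | tri≈ _ refl _ = [] , prefix c d le
    infix-of (end _ _ _ _) d _ le | tri< lt _ _ = ⊥-elim (<⇒≱ lt (≤-trans (head≤last d) le))
    infix-of {v = v} (link {s = s} {n′ = n′} _ _ _ _ _ gap c) d _ le | tri< lt _ _ with v <? n′
    ... | yes v<n′ = ⊥-elim (gap-avoids-head gap d lt v<n′)
    ... | no v≮n′ = let pre , post , e = infix-of c d (≮⇒≥ v≮n′) le in s ∷ pre , post , cong (s ∷_) e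

    take-prefix : ∀ {n} t ts post (c : Chain p n (t ∷ ts ++ post)) →
                  Σ (Chain p n (t ∷ ts)) λ d → last d ≤ last c
    take-prefix t []        []         c = c , ≤-refl
    take-prefix t []        (_ ∷ post) c@(link {m = m} h 1≤s s≤p a _ _ _) = end {m = m} h 1≤s s≤p a , head≤last c
    take-prefix t (t′ ∷ ts) post (link {m = m} h 1≤s s≤p a lt gap c) =
      let d , le = take-prefix t′ ts post c in link {m = m} h 1≤s s≤p a lt gap d , le

    sub-chain : ∀ {n} pre t ts post (c : Chain p n (pre ++ t ∷ ts ++ post)) →
                ∃ λ v → Σ (Chain p v (t ∷ ts)) λ d → n ≤ v × last d ≤ last c
    sub-chain []              t ts post c = let d , le = take-prefix t ts post c in _ , d , ≤-refl , le
    sub-chain (_ ∷ [])        t ts post (link _ _ _ _ lt _ c) =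
      let v , d , n≤v , le = sub-chain [] t ts post c in v , d , ≤-trans (<⇒≤ lt) n≤v , le
    sub-chain (_ ∷ s ∷ pre)   t ts post (link _ _ _ _ lt _ c) =
      let v , d , n≤v , le = sub-chain (s ∷ pre) t ts post c in v , d , ≤-trans (<⇒≤ lt) n≤v , le

    module _ {n₀ n₁ : ℕ} (high : p + 2 ≤ n₀) where

      private
        w = k ^ p
        lo = k ^ n₀
        hi = k ^ n₁

      k^-reflects-≤ : ∀ {a b} → k ^ a ≤ k ^ b → a ≤ b
      k^-reflects-≤ le = ≮⇒≥ λ lt → <⇒≱ (^-monoʳ-< k 1<k lt) le

      mem-bounds : ∀ v → Mem w lo hi (k ^ v) → n₀ ≤ v × v ≤ n₁
      mem-bounds _ (_ , l , h , _) = k^-reflects-≤ (LE⇒≤ l) , k^-reflects-≤ (LE⇒≤ h)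

      near⇒mem : ∀ {v m} → n₀ ≤ v → v ≤ n₁ → Near p v m → Mem w lo hi (k ^ v)
      near⇒mem {v} {m} n₀≤v v≤n₁ (l , h) =
        (v , refl) , ≤⇒LE (^-monoʳ-≤ k n₀≤v) , ≤⇒LE (^-monoʳ-≤ k v≤n₁) , ℓ ^ m , (m , refl) , ≤⇒LE l , <⇒LT h

      mem⇒near : ∀ v → Mem w lo hi (k ^ v) → ∃ λ m → Near p v m
      mem⇒near _ (_ , _ , _ , _ , (m , refl) , l , h) = m , LE⇒≤ l , LT⇒< h

      next⇒gap : ∀ {u v} → Next w lo hi (k ^ u) (k ^ v) → u < v × Gap p u v
      next⇒gap {u} {v} (mem-u , mem-v , lt , none) = k^-reflects-< (LT⇒< lt) , λ x m u<x x<v near →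
        none (k ^ x , near⇒mem {x} {m} (≤-trans (proj₁ (mem-bounds u mem-u)) (<⇒≤ u<x))
                (≤-trans (<⇒≤ x<v) (proj₂ (mem-bounds v mem-v))) near ,
              <⇒LT (^-monoʳ-< k 1<k u<x) , <⇒LT (^-monoʳ-< k 1<k x<v))

      gap⇒next : ∀ {u v} → Mem w lo hi (k ^ u) → Mem w lo hi (k ^ v) → u < v → Gap p u v →
                 Next w lo hi (k ^ u) (k ^ v)
      gap⇒next mem-u mem-v u<v gap = mem-u , mem-v , <⇒LT (^-monoʳ-< k 1<k u<v) ,
        λ { (_ , mem-x@((x , refl) , _) , u<x , x<v) →
            gap x (proj₁ (mem⇒near x mem-x)) (k^-reflects-< (LT⇒< u<x)) (k^-reflects-< (LT⇒< x<v)) (proj₂ (mem⇒near x mem-x)) }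

      val⇒digit : ∀ {v s} → Val w (k ^ v) (k ^ (p ∸ s)) → 1 ≤ s × ∃ λ m → Digit p s v m
      val⇒digit {s = zero}  (_ , le , _) = ⊥-elim (<⇒≱ (m<m+n (k ^ p) (m^n>0 k p)) (LE⇒≤ le))
      val⇒digit {s = suc s} (_ , _ , _ , (m , refl) , l , h) = s≤s z≤n , m , LE⇒≤ l , LT⇒< h

      digit⇒val : ∀ {v s m} → 1 ≤ s → s ≤ p → Digit p s v m → Val w (k ^ v) (k ^ (p ∸ s))
      digit⇒val {s = s} {m} 1≤s s≤p (l , h) = (p ∸ s , refl) ,
        ≤⇒LE (≤-trans (double (p ∸ s)) (^-monoʳ-≤ k (∸-monoʳ-< 1≤s s≤p))) ,
        ℓ ^ m , (m , refl) , ≤⇒LE l , <⇒LT h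

      row⇒chain : ∀ {s₀ s₁ s₂ s₃} → s₀ ≤ p → s₁ ≤ p → s₂ ≤ p → s₃ ≤ p →
                  Row w lo hi (k ^ (p ∸ s₀)) (k ^ (p ∸ s₁)) (k ^ (p ∸ s₂)) (k ^ (p ∸ s₃)) →
                  ∃ λ v → Σ (Chain p v (s₀ ∷ s₁ ∷ s₂ ∷ s₃ ∷ [])) λ c → n₀ ≤ v × last c ≤ n₁
      row⇒chain {s₀} {s₁} {s₂} {s₃} s₀≤p s₁≤p s₂≤p s₃≤p
        (_ , _ , _ , _ , next₀@(mem₀@((v₀ , refl) , _) , mem₁@((v₁ , refl) , _) , _) ,
         next₁@(_ , mem₂@((v₂ , refl) , _) , _) , next₂@(_ , mem₃@((v₃ , refl) , _) , _) ,
         val₀ , val₁ , val₂ , val₃) =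
        let 1≤s₀ , m₀ , d₀ = val⇒digit {v₀} {s₀} val₀
            1≤s₁ , m₁ , d₁ = val⇒digit {v₁} {s₁} val₁
            1≤s₂ , m₂ , d₂ = val⇒digit {v₂} {s₂} val₂
            1≤s₃ , m₃ , d₃ = val⇒digit {v₃} {s₃} val₃
            lt₀ , gap₀ = next⇒gap {v₀} {v₁} next₀
            lt₁ , gap₁ = next⇒gap {v₁} {v₂} next₁
            lt₂ , gap₂ = next⇒gap {v₂} {v₃} next₂
            h : ∀ v → Mem w lo hi (k ^ v) → p + 2 ≤ v
            h v mem = ≤-trans high (proj₁ (mem-bounds v mem))
        in v₀ , link {m = m₀} (h v₀ mem₀) 1≤s₀ s₀≤p d₀ lt₀ gap₀
                  (link {m = m₁} (h v₁ mem₁) 1≤s₁ s₁≤p d₁ lt₁ gap₁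
                    (link {m = m₂} (h v₂ mem₂) 1≤s₂ s₂≤p d₂ lt₂ gap₂
                      (end {m = m₃} (h v₃ mem₃) 1≤s₃ s₃≤p d₃))) ,
           proj₁ (mem-bounds v₀ mem₀) , proj₂ (mem-bounds v₃ mem₃)

      chain⇒row : ∀ {v s₀ s₁ s₂ s₃} (c : Chain p v (s₀ ∷ s₁ ∷ s₂ ∷ s₃ ∷ [])) → n₀ ≤ v → last c ≤ n₁ →
                  Row w lo hi (k ^ (p ∸ s₀)) (k ^ (p ∸ s₁)) (k ^ (p ∸ s₂)) (k ^ (p ∸ s₃))
      chain⇒row {v₀} {s₀} {s₁} {s₂} {s₃}
        (link {m = m₀} _ 1≤s₀ s₀≤p d₀ lt₀ gap₀
          (link {n = v₁} {m = m₁} _ 1≤s₁ s₁≤p d₁ lt₁ gap₁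
            (link {n = v₂} {m = m₂} _ 1≤s₂ s₂≤p d₂ lt₂ gap₂
              (end {n = v₃} {m = m₃} _ 1≤s₃ s₃≤p d₃)))) n₀≤v₀ v₃≤n₁ =
        _ , _ , _ , _ , gap⇒next mem₀ mem₁ lt₀ gap₀ , gap⇒next mem₁ mem₂ lt₁ gap₁ , gap⇒next mem₂ mem₃ lt₂ gap₂ ,
        digit⇒val {v₀} {s₀} {m₀} 1≤s₀ s₀≤p d₀ , digit⇒val {v₁} {s₁} {m₁} 1≤s₁ s₁≤p d₁ ,
        digit⇒val {v₂} {s₂} {m₂} 1≤s₂ s₂≤p d₂ , digit⇒val {v₃} {s₃} {m₃} 1≤s₃ s₃≤p d₃
        where
        n₀≤v₁ = ≤-trans n₀≤v₀ (<⇒≤ lt₀)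
        n₀≤v₂ = ≤-trans n₀≤v₁ (<⇒≤ lt₁)
        n₀≤v₃ = ≤-trans n₀≤v₂ (<⇒≤ lt₂)
        v₂≤n₁ = ≤-trans (<⇒≤ lt₂) v₃≤n₁
        v₁≤n₁ = ≤-trans (<⇒≤ lt₁) v₂≤n₁
        v₀≤n₁ = ≤-trans (<⇒≤ lt₀) v₁≤n₁
        mem₀ = near⇒mem {v₀} {m₀} n₀≤v₀ v₀≤n₁ (digit⇒near {p} {s₀} {v₀} {m₀} 1≤s₀ s₀≤p d₀)
        mem₁ = near⇒mem {v₁} {m₁} n₀≤v₁ v₁≤n₁ (digit⇒near {p} {s₁} {v₁} {m₁} 1≤s₁ s₁≤p d₁)
        mem₂ = near⇒mem {v₂} {m₂} n₀≤v₂ v₂≤n₁ (digit⇒near {p} {s₂} {v₂} {m₂} 1≤s₂ s₂≤p d₂)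
        mem₃ = near⇒mem {v₃} {m₃} n₀≤v₃ v₃≤n₁ (digit⇒near {p} {s₃} {v₃} {m₃} 1≤s₃ s₃≤p d₃)

-- Programs and the soundness of closed tables

-- Subfunctions are named by their positions in a flat list, which provides finitely many numerals
-- to serve as tags of table rows.
data Instr : Set where
  zeroI succI : Instr
  projI : ℕ → Instr
  compI : ℕ → List ℕ → Instr
  precI : ℕ → ℕ → Instr
  muI   : ℕ → Instr

Program : Set
Program = List Instr

data At : Program → ℕ → Instr → Set where
  at-head : ∀ {i P} → At (i ∷ P) 0 i
  at-tail : ∀ {i j P t} → At P t i → At (j ∷ P) (suc t) i

At-unique : ∀ {P t i j} → At P t i → At P t j → i ≡ j
At-unique at-head     at-head     = refl
At-unique (at-tail a) (at-tail b) = At-unique a b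

At-< : ∀ {P t i} → At P t i → t < length P
At-< at-head     = s≤s z≤n
At-< (at-tail a) = s≤s (At-< a)

At-++ : ∀ {P t i} Q → At P t i → At (P ++ Q) t i
At-++ Q at-head     = at-head
At-++ Q (at-tail a) = at-tail (At-++ Q a)

At-end : ∀ P i → At (P ++ i ∷ []) (length P) i
At-end []      i = at-head
At-end (_ ∷ P) i = at-tail (At-end P i)

mutual
  data Implements (P : Program) : ∀ {n} → ℕ → PR n → Set where
    zeroM : ∀ {n t} → At P t zeroI → Implements P t (zeroF {n})
    succM : ∀ {t} → At P t succI → Implements P t succF
    projM : ∀ {n t} {i : Fin n} → At P t (projI (toℕ i)) → Implements P t (proj i)
    compM : ∀ {m n t u us} {f : PR m} {gs : Vec (PR n) m} → At P t (compI u us) →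
            Implements P u f → Implements* P us gs → Implements P t (comp f gs)
    precM : ∀ {n t u v} {f : PR n} {g} → At P t (precI u v) →
            Implements P u f → Implements P v g → Implements P t (prec f g)
    muM   : ∀ {n t u} {f : PR (suc n)} → At P t (muI u) → Implements P u f → Implements P t (mu f)

  data Implements* (P : Program) : ∀ {m n} → List ℕ → Vec (PR n) m → Set where
    []M  : ∀ {n} → Implements* P [] ([] {A = PR n})
    _∷M_ : ∀ {m n t ts} {g : PR n} {gs : Vec (PR n) m} →
           Implements P t g → Implements* P ts gs → Implements* P (t ∷ ts) (g ∷ gs)

_⊑_ : Program → Program → Set
P ⊑ R = ∀ {t i} → At P t i → At R t i

mutual
  weaken : ∀ {P R n t} {f : PR n} → P ⊑ R → Implements P t f → Implements R t f
  weaken P⊑R (zeroM a)       = zeroM (P⊑R a)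
  weaken P⊑R (succM a)       = succM (P⊑R a)
  weaken P⊑R (projM a)       = projM (P⊑R a)
  weaken P⊑R (compM a mf mg) = compM (P⊑R a) (weaken P⊑R mf) (weaken* P⊑R mg)
  weaken P⊑R (precM a mf mg) = precM (P⊑R a) (weaken P⊑R mf) (weaken P⊑R mg)
  weaken P⊑R (muM a mf)      = muM (P⊑R a) (weaken P⊑R mf)

  weaken* : ∀ {P R m n ts} {gs : Vec (PR n) m} → P ⊑ R → Implements* P ts gs → Implements* R ts gs
  weaken* P⊑R []M       = []M
  weaken* P⊑R (m ∷M ms) = weaken P⊑R m ∷M weaken* P⊑R ms

_▷_ : Program → Instr → Program
P ▷ i = P ++ i ∷ []

grow : ∀ {P i} → P ⊑ (P ▷ i)
grow = At-++ _

mutual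
  compile : ∀ {n} (f : PR n) P → ∃₂ λ R t → P ⊑ R × Implements R t f
  compile zeroF       P = P ▷ zeroI , length P , grow , zeroM (At-end P zeroI)
  compile succF       P = P ▷ succI , length P , grow , succM (At-end P succI)
  compile (proj i)    P = P ▷ projI (toℕ i) , length P , grow , projM (At-end P (projI (toℕ i)))
  compile (comp f gs) P with compile f P
  ... | R₁ , u , ext₁ , mf with compile* gs R₁
  ... | R₂ , us , ext₂ , mg = R₂ ▷ compI u us , length R₂ , grow ∘ ext₂ ∘ ext₁ ,
    compM (At-end R₂ _) (weaken (grow ∘ ext₂) mf) (weaken* grow mg)
  compile (prec f g)  P with compile f P
  ... | R₁ , u , ext₁ , mf with compile g R₁
  ... | R₂ , v , ext₂ , mg = R₂ ▷ precI u v , length R₂ , grow ∘ ext₂ ∘ ext₁ ,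
    precM (At-end R₂ _) (weaken (grow ∘ ext₂) mf) (weaken grow mg)
  compile (mu f)      P with compile f P
  ... | R₁ , u , ext , mf = R₁ ▷ muI u , length R₁ , grow ∘ ext , muM (At-end R₁ _) (weaken grow mf)

  compile* : ∀ {m n} (gs : Vec (PR n) m) P → ∃₂ λ R ts → P ⊑ R × Implements* R ts gs
  compile* []       P = P , [] , (λ a → a) , []M
  compile* (g ∷ gs) P with compile g P
  ... | R₁ , t , ext₁ , m with compile* gs R₁
  ... | R₂ , ts , ext₂ , ms = R₂ , t ∷ ts , ext₂ ∘ ext₁ , weaken ext₂ m ∷M ms

-- Queries asserting that a table is closed

-- Row (1, i, h, t) says that i codes the list with head h and tail coded by t;
-- row (2 + t, a, y, y) says that instruction t maps the argument list coded by a to y.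

projQ : ∀ {d} → ℕ → Fin d → Fin d → Query d
projQ zero    a y = exQ (row 1 (1 ↑ʳ a) (1 ↑ʳ y) 0F)
projQ (suc i) a y = exQ (exQ (andQ (row 1 (2 ↑ʳ a) 1F 0F) (projQ i 0F (2 ↑ʳ y))))

argsQ : ∀ {d} → List ℕ → Fin d → Fin d → Query d
-- A trivially true query: the empty list is not recorded by any row.
argsQ []       a b = eqQ a a
argsQ (t ∷ ts) a b = exQ (exQ (andQ (row 1 (2 ↑ʳ b) 1F 0F)
  (andQ (row (2 + t) (2 ↑ʳ a) 1F 1F) (argsQ ts (2 ↑ʳ a) 0F))))

-- In `precₛQ` the variables 6F to 0F are the recursion argument, the list of parameters, the
-- predecessor, the previous value, the argument list of the recursive call, the parameters with the
-- previous value in front, and the argument list of the step function.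
prec₀Q precₛQ : ∀ {d} → ℕ → ℕ → Fin d → Fin d → Query d
prec₀Q t u a y = exQ (exQ (andQ (row 1 (2 ↑ʳ a) 1F 0F) (andQ (zeroQ 1F) (row (2 + u) 0F (2 ↑ʳ y) (2 ↑ʳ y)))))
precₛQ t v a y = exQ (exQ (exQ (exQ (exQ (exQ (exQ (
  andQ (row 1 (7 ↑ʳ a) 6F 5F) (andQ (sucQ 4F 6F) (andQ (row 1 2F 4F 5F) (andQ (row (2 + t) 2F 3F 3F)
  (andQ (row 1 1F 3F 5F) (andQ (row 1 0F 4F 1F) (row (2 + v) 0F (7 ↑ʳ y) (7 ↑ʳ y))))))))))))))

-- One unfolding of the defining equations: an entry must be supported by further rows of the same
-- table. With only negation, conjunction and existence at hand, the disjunction for `precI` and the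
-- bounded universal quantifier for `muI` are written by duality.
justQ : ∀ {d} → ℕ → Instr → Fin d → Fin d → Query d
justQ t zeroI        a y = zeroQ y
justQ t succI        a y = exQ (exQ (andQ (row 1 (2 ↑ʳ a) 1F 0F) (sucQ 1F (2 ↑ʳ y))))
justQ t (projI i)    a y = projQ i a y
justQ t (compI u us) a y = exQ (andQ (row (2 + u) 0F (1 ↑ʳ y) (1 ↑ʳ y)) (argsQ us (1 ↑ʳ a) 0F))
justQ t (precI u v)  a y = notQ (andQ (notQ (prec₀Q t u a y)) (notQ (precₛQ t v a y)))
justQ t (muI u)      a y = andQ
  (exQ (exQ (andQ (row 1 1F (2 ↑ʳ y) (2 ↑ʳ a)) (andQ (zeroQ 0F) (row (2 + u) 1F 0F 0F)))))
  (notQ (exQ (andQ (ltQ 0F (1 ↑ʳ y)) (notQ (exQ (exQ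
    (andQ (row 1 1F 2F (3 ↑ʳ a)) (andQ (row (2 + u) 1F 0F 0F) (notQ (zeroQ 0F))))))))))

entryQ : ∀ {d} → ℕ → Instr → Query d
entryQ t i = notQ (exQ (exQ (andQ (row (2 + t) 1F 0F 0F) (notQ (justQ t i 1F 0F)))))

-- All that is demanded of list codes is that they decode uniquely, so no pairing function has to be
-- expressed in the structure.
consQ : ∀ {d} → Query d
consQ = notQ (exQ (exQ (exQ (exQ (exQ (andQ (row 1 4F 3F 2F) (andQ (row 1 4F 1F 0F)
  (notQ (andQ (eqQ 3F 1F) (eqQ 2F 0F))))))))))

entriesQ : ∀ {d} → ℕ → Program → Query d
-- Always true; it binds a variable of its own because d may be 0.
entriesQ t []      = notQ (exQ (ltQ 0F 0F))
entriesQ t (i ∷ P) = andQ (entryQ t i) (entriesQ (suc t) P)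

closedQ : ∀ {d} → Program → Query d
closedQ P = andQ consQ (entriesQ 0 P)

module _ {T : ℕ → ℕ → ℕ → ℕ → Set} {B : ℕ} where

  open Query⟦⟧ T B

  entries-at : ∀ {d} {σ : Fin d → ℕ} n {P t i} → ⟦ entriesQ n P ⟧ σ → At P t i → ⟦ entryQ (n + t) i ⟧ σ
  entries-at {σ = σ} n {i = i} (e , _) at-head = subst (λ t → ⟦ entryQ t i ⟧ σ) (sym (+-identityʳ n)) e
  entries-at {σ = σ} n {i = i} (_ , es) (at-tail {t = t} a) =
    subst (λ t → ⟦ entryQ t i ⟧ σ) (sym (+-suc n t)) (entries-at (suc n) es a)

  entries-all : ∀ {d} {σ : Fin d → ℕ} n P → (∀ {t i} → At P t i → ⟦ entryQ (n + t) i ⟧ σ) → ⟦ entriesQ n P ⟧ σ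
  entries-all n []      h = λ { (_ , _ , n<n) → <-irrefl refl n<n }
  entries-all {σ = σ} n (i ∷ P) h = subst (λ t → ⟦ entryQ t i ⟧ σ) (+-identityʳ n) (h at-head) ,
    entries-all (suc n) P λ {t} {i} a → subst (λ t → ⟦ entryQ t i ⟧ σ) (+-suc n t) (h (at-tail a))

  module Soundness {d P} {σ : Fin d → ℕ} (closed : ⟦ closedQ P ⟧ σ) where

    cons-functional : ∀ {i h t h′ t′} → i ≤ B → h ≤ B → t ≤ B → h′ ≤ B → t′ ≤ B →
                      T 1 i h t → T 1 i h′ t′ → h ≡ h′ × t ≡ t′
    cons-functional {i} {h} {t} {h′} {t′} i≤ h≤ t≤ h′≤ t′≤ r r′ =
      decidable-stable (h ≟ h′) (λ ne → absurd (ne ∘ proj₁)) ,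
      decidable-stable (t ≟ t′) (λ ne → absurd (ne ∘ proj₂))
      where
      absurd : ¬ (h ≡ h′ × t ≡ t′) → ⊥
      absurd ne = proj₁ closed (i , i≤ , h , h≤ , t , t≤ , h′ , h′≤ , t′ , t′≤ , r , r′ , ne)

    justified : ∀ {t i a y} → At P t i → a ≤ B → y ≤ B → T (2 + t) a y y →
                ¬ ¬ ⟦ justQ t i 1F 0F ⟧ (y ∷ᶠ (a ∷ᶠ σ))
    justified {a = a} {y} at a≤ y≤ r unjust =
      entries-at {σ = σ} 0 (proj₂ closed) at (a , a≤ , y , y≤ , r , unjust)

    -- Any number codes the empty list: the arity decides how many entries of a code are read.
    Codes : ∀ {n} → ℕ → Vec ℕ n → Set
    Codes a []       = ⊤
    Codes a (x ∷ xs) = x ≤ B × ∃ λ t → t ≤ B × T 1 a x t × Codes t xs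

    proj-sound : ∀ {d n} {σ : Fin d → ℕ} {xs : Vec ℕ n} (i : Fin n) a y → Codes (σ a) xs → σ a ≤ B → σ y ≤ B →
                 ⟦ projQ (toℕ i) a y ⟧ σ → σ y ≡ lookup xs i
    proj-sound {xs = x ∷ xs} fzero a y (x≤ , t , t≤ , r , _) a≤ y≤ (t′ , t′≤ , r′) =
      proj₁ (cons-functional a≤ y≤ t′≤ x≤ t≤ r′ r)
    proj-sound {σ = σ} {xs = x ∷ xs} (fsuc i) a y (x≤ , t , t≤ , r , codes) a≤ y≤ (x′ , x′≤ , t′ , t′≤ , r′ , rest)
      with cons-functional a≤ x′≤ t′≤ x≤ t≤ r′ r
    ... | refl , refl = proj-sound {σ = t ∷ᶠ (x ∷ᶠ σ)} i 0F (2 ↑ʳ y) codes t≤ y≤ rest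

    mutual
      -- Local justification may be circular, so the induction is on the derivation and not on the
      -- table: where f converges, the supporting rows concern smaller derivations and have the
      -- correct values. For minimisation, a y₀ below y contradicts the nonzero value of f at y₀,
      -- and a y₀ above y contradicts the value 0 at y.
      sound : ∀ {n t a y₀ y} {f : PR n} {xs} → Implements P t f → f ⟦ xs ⟧⇓ y → Codes a xs →
              a ≤ B → y₀ ≤ B → T (2 + t) a y₀ y₀ → y₀ ≡ y
      sound {y₀ = y₀} m d codes a≤ y₀≤ r = decidable-stable (y₀ ≟ _) (refute m d codes a≤ y₀≤ r)

      -- Closedness is a negated statement and provides justifications only up to double negation;
      -- equality of numbers is decidable, which lets `sound` remove it.
      refute : ∀ {n t a y₀ y} {f : PR n} {xs} → Implements P t f → f ⟦ xs ⟧⇓ y → Codes a xs →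
               a ≤ B → y₀ ≤ B → T (2 + t) a y₀ y₀ → ¬ ¬ y₀ ≡ y
      refute (zeroM at) zero⇓ codes a≤ y≤ r ne = justified at a≤ y≤ r ne
      refute (succM at) succ⇓ (x≤ , t , t≤ , c , _) a≤ y≤ r ne = justified at a≤ y≤ r
        λ { (x′ , x′≤ , t′ , t′≤ , c′ , e) →
            ne (trans e (cong suc (proj₁ (cons-functional a≤ x′≤ t′≤ x≤ t≤ c′ c)))) }
      refute {a = a} {y₀} (projM {i = i} at) proj⇓ codes a≤ y≤ r ne = justified at a≤ y≤ r
        λ j → ne (proj-sound {σ = y₀ ∷ᶠ (a ∷ᶠ σ)} i 1F 0F codes a≤ y≤ j)
      refute {a = a} {y₀} (compM at mf mg) (comp⇓ ds d) codes a≤ y≤ r ne = justified at a≤ y≤ r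
        λ { (b , b≤ , s , args) →
            ne (sound mf d (sound* {σ = b ∷ᶠ (y₀ ∷ᶠ (a ∷ᶠ σ))} 2F 0F mg ds codes a≤ b≤ args) b≤ y≤ s) }
      refute (precM at mf mg) (prec0⇓ d) (0≤ , t , t≤ , c , codes) a≤ y≤ r ne = justified at a≤ y≤ r
        λ j → j ((λ { (x′ , x′≤ , t′ , t′≤ , c′ , _ , s) → zero-case x′≤ t′≤ c′ s }) ,
                 (λ { (x′ , x′≤ , t′ , t′≤ , _ , _ , _ , _ , _ , _ , _ , _ , _ , _ , c′ , e , _) →
                      suc-case (trans (sym (proj₁ (cons-functional a≤ x′≤ t′≤ 0≤ t≤ c′ c))) e) }))
        where
        zero-case : ∀ {x′ t′} → x′ ≤ B → t′ ≤ B → T 1 _ x′ t′ → T (2 + _) t′ _ _ → ⊥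
        zero-case x′≤ t′≤ c′ s with cons-functional a≤ x′≤ t′≤ 0≤ t≤ c′ c
        ... | refl , refl = ne (sound mf d codes t≤ y≤ s)
        suc-case : ∀ {n} → 0 ≡ suc n → ⊥
        suc-case ()
      refute (precM at mf mg) (precS⇓ {x = x} d e) (sx≤ , t , t≤ , c , codes) a≤ y≤ r ne = justified at a≤ y≤ r
        λ j → j ((λ { (x′ , x′≤ , t′ , t′≤ , c′ , z , s) →
                      zero-case (trans (sym (proj₁ (cons-functional a≤ x′≤ t′≤ sx≤ t≤ c′ c))) z) }) ,
                 (λ { (x₁ , x₁≤ , t₁ , t₁≤ , x′ , x′≤ , r₁ , r₁≤ , a₁ , a₁≤ , t₂ , t₂≤ , a₂ , a₂≤ ,
                       c₀ , e₀ , c₁ , s₁ , c₂ , c₃ , s₂) →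
                      suc-case x₁≤ t₁≤ x′≤ r₁≤ a₁≤ t₂≤ a₂≤ c₀ e₀ c₁ s₁ c₂ c₃ s₂ }))
        where
        zero-case : ∀ {n} → suc n ≡ 0 → ⊥
        zero-case ()
        suc-case : ∀ {x₁ t₁ x′ r₁ a₁ t₂ a₂} → x₁ ≤ B → t₁ ≤ B → x′ ≤ B → r₁ ≤ B → a₁ ≤ B → t₂ ≤ B → a₂ ≤ B →
                   T 1 _ x₁ t₁ → x₁ ≡ suc x′ → T 1 a₁ x′ t₁ → T (2 + _) a₁ r₁ r₁ → T 1 t₂ r₁ t₁ →
                   T 1 a₂ x′ t₂ → T (2 + _) a₂ _ _ → ⊥
        suc-case x₁≤ t₁≤ x′≤ r₁≤ a₁≤ t₂≤ a₂≤ c₀ e₀ c₁ s₁ c₂ c₃ s₂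
          with cons-functional a≤ x₁≤ t₁≤ sx≤ t≤ c₀ c | e₀
        ... | refl , refl | refl with sound (precM at mf mg) d (x′≤ , t , t≤ , c₁ , codes) a₁≤ r₁≤ s₁
        ... | refl = ne (sound mg e (x′≤ , _ , t₂≤ , c₃ , r₁≤ , t , t≤ , c₂ , codes) a₂≤ y≤ s₂)
      refute {y₀ = y₀} (muM at mf) (mu⇓ {y = y} d below) codes a≤ y₀≤ r ne = justified at a≤ y₀≤ r λ j → case j (<-cmp y₀ y)
        where
        case : _ → _ → ⊥
        case _ (tri≈ _ e _) = ne e
        case ((a₀ , a₀≤ , z , z≤ , c , z≡0 , s) , _) (tri< lt _ _) with below y₀ lt
        ... | v , d′ with trans (sym z≡0) (sound mf d′ (y₀≤ , _ , a≤ , c , codes) a₀≤ z≤ s)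
        ... | ()
        case (_ , h) (tri> _ _ gt) = h (y , y≤ , gt ,
          λ { (a₁ , a₁≤ , v , v≤ , c , s , v≢0) → v≢0 (sound mf d (y≤ , _ , a≤ , c , codes) a₁≤ v≤ s) })
          where
          y≤ = ≤-trans (<⇒≤ gt) y₀≤

      sound* : ∀ {d m n us} {σ : Fin d → ℕ} {gs : Vec (PR n) m} {xs ys} a b → Implements* P us gs →
               gs ⟦ xs ⟧⇓* ys → Codes (σ a) xs → σ a ≤ B → σ b ≤ B → ⟦ argsQ us a b ⟧ σ → Codes (σ b) ys
      sound* a b []M []⇓ codes a≤ b≤ h = tt
      sound* {σ = σ} a b (m ∷M ms) (d ∷⇓ ds) codes a≤ b≤ (z , z≤ , b′ , b′≤ , c , s , rest)
        with sound m d codes a≤ z≤ s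
      ... | refl = z≤ , b′ , b′≤ , c , sound* {σ = b′ ∷ᶠ (z ∷ᶠ σ)} (2 ↑ʳ a) 0F ms ds codes a≤ b′≤ rest

-- Closed tables from derivations

tri-mono-≤ : ∀ {m n} → m ≤ n → tri m ≤ tri n
tri-mono-≤ z≤n       = z≤n
tri-mono-≤ (s≤s m≤n) = +-mono-≤ (s≤s m≤n) (tri-mono-≤ m≤n)

-- `pair a b` lies between `tri (a + b)` and `tri (suc (a + b))`, the latter excluded, and these
-- blocks are disjoint for different sums.
pair-sum-≮ : ∀ {a b c d} → pair a b ≡ pair c d → ¬ a + b < c + d
pair-sum-≮ {a} {b} {c} {d} e lt = <-irrefl e (begin-strict
  tri (a + b) + b          ≤⟨ +-monoʳ-≤ (tri (a + b)) (m≤n+m b a) ⟩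
  tri (a + b) + (a + b)    ≡⟨ +-comm (tri (a + b)) (a + b) ⟩
  a + b + tri (a + b)      <⟨ ≤-refl ⟩
  tri (suc (a + b))        ≤⟨ tri-mono-≤ lt ⟩
  tri (c + d)              ≤⟨ m≤m+n (tri (c + d)) d ⟩
  tri (c + d) + d          ∎)

pair-injective : ∀ {a b c d} → pair a b ≡ pair c d → a ≡ c × b ≡ d
pair-injective {a} {b} {c} {d} e with <-cmp (a + b) (c + d)
... | tri< lt _ _ = ⊥-elim (pair-sum-≮ {a} {b} {c} {d} e lt)
... | tri> _ _ gt = ⊥-elim (pair-sum-≮ {c} {d} {a} {b} (sym e) gt)
... | tri≈ _ s _ = +-cancelʳ-≡ b a c (trans s (cong (c +_) (sym b≡d))) , b≡d
  where
  b≡d : b ≡ d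
  b≡d = +-cancelˡ-≡ (tri (a + b)) b d (trans e (cong (λ n → tri n + d) (sym s)))

TableRow : Set
TableRow = ℕ × ℕ × ℕ × ℕ

codeList : ∀ {n} → Vec ℕ n → ℕ
codeList []       = 0
codeList (x ∷ xs) = pair x (codeList xs)

consRow : ℕ → ℕ → TableRow
consRow h t = 1 , pair h t , h , t

evalRow : ℕ → ℕ → ℕ → TableRow
evalRow t a y = 2 + t , a , y , y

_⊆_ : List TableRow → List TableRow → Set
F ⊆ G = ∀ {r} → r ∈ F → r ∈ G

module _ (F : List TableRow) where

  ProjJ : ℕ → ℕ → ℕ → Set
  ProjJ zero    a y = ∃ λ t → (1 , a , y , t) ∈ F
  ProjJ (suc i) a y = ∃₂ λ x t → (1 , a , x , t) ∈ F × ProjJ i t y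

  ArgsJ : List ℕ → ℕ → ℕ → Set
  ArgsJ []       a b = ⊤
  ArgsJ (t ∷ ts) a b = ∃₂ λ z b′ → (1 , b , z , b′) ∈ F × evalRow t a z ∈ F × ArgsJ ts a b′

  BelowJ : ℕ → ℕ → ℕ → Set
  BelowJ u a y = ∀ z → z < y → ∃₂ λ a₁ v → (1 , a₁ , z , a) ∈ F × evalRow u a₁ (suc v) ∈ F

  -- The positive form of `justQ`, evidently monotone in F, so that the tables of subderivations may
  -- be joined.
  data Just (t a y : ℕ) : Instr → Set where
    zeroJ  : y ≡ 0 → Just t a y zeroI
    succJ  : ∀ {x b} → (1 , a , x , b) ∈ F → y ≡ suc x → Just t a y succI
    projJ  : ∀ {i} → ProjJ i a y → Just t a y (projI i)
    compJ  : ∀ {u us b} → evalRow u b y ∈ F → ArgsJ us a b → Just t a y (compI u us)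
    prec₀J : ∀ {u v b} → (1 , a , 0 , b) ∈ F → evalRow u b y ∈ F → Just t a y (precI u v)
    precₛJ : ∀ {u v x b r a₁ b₁ a₂} → (1 , a , suc x , b) ∈ F → (1 , a₁ , x , b) ∈ F → evalRow t a₁ r ∈ F →
             (1 , b₁ , r , b) ∈ F → (1 , a₂ , x , b₁) ∈ F → evalRow v a₂ y ∈ F → Just t a y (precI u v)
    muJ    : ∀ {u a₀} → (1 , a₀ , y , a) ∈ F → evalRow u a₀ 0 ∈ F → BelowJ u a y → Just t a y (muI u)

ProjJ-mono : ∀ {F G} → F ⊆ G → ∀ i {a y} → ProjJ F i a y → ProjJ G i a y
ProjJ-mono F⊆G zero    (t , r)         = t , F⊆G r
ProjJ-mono F⊆G (suc i) (x , t , r , j) = x , t , F⊆G r , ProjJ-mono F⊆G i j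

ArgsJ-mono : ∀ {F G} → F ⊆ G → ∀ ts {a b} → ArgsJ F ts a b → ArgsJ G ts a b
ArgsJ-mono F⊆G []       _                    = tt
ArgsJ-mono F⊆G (t ∷ ts) (z , b′ , c , r , j) = z , b′ , F⊆G c , F⊆G r , ArgsJ-mono F⊆G ts j

Just-mono : ∀ {F G t a y i} → F ⊆ G → Just F t a y i → Just G t a y i
Just-mono F⊆G (zeroJ e)              = zeroJ e
Just-mono F⊆G (succJ c e)            = succJ (F⊆G c) e
Just-mono F⊆G (projJ {i = i} j)      = projJ (ProjJ-mono F⊆G i j)
Just-mono F⊆G (compJ {us = us} r j)  = compJ (F⊆G r) (ArgsJ-mono F⊆G us j)
Just-mono F⊆G (prec₀J c r)           = prec₀J (F⊆G c) (F⊆G r)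
Just-mono F⊆G (precₛJ c₀ c₁ r c₂ c₃ s) = precₛJ (F⊆G c₀) (F⊆G c₁) (F⊆G r) (F⊆G c₂) (F⊆G c₃) (F⊆G s)
Just-mono F⊆G (muJ c r below)        = muJ (F⊆G c) (F⊆G r)
  λ z z<y → let a₁ , v , c₁ , r₁ = below z z<y in a₁ , v , F⊆G c₁ , F⊆G r₁

module Completeness (P : Program) where

  data Justified (F : List TableRow) : TableRow → Set where
    consR : ∀ {h t} → Justified F (consRow h t)
    evalR : ∀ {t i a y} → At P t i → Just F t a y i → Justified F (evalRow t a y)

  Good : List TableRow → Set
  Good F = ∀ {r} → r ∈ F → Justified F r

  Justified-mono : ∀ {F G r} → F ⊆ G → Justified F r → Justified G r
  Justified-mono F⊆G consR       = consR
  Justified-mono F⊆G (evalR at j) = evalR at (Just-mono F⊆G j)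

  Good-++ : ∀ {F G} → Good F → Good G → Good (F ++ G)
  Good-++ {F} gF gG r∈ with ∈-++⁻ F r∈
  ... | inj₁ r∈F = Justified-mono ∈-++⁺ˡ (gF r∈F)
  ... | inj₂ r∈G = Justified-mono (∈-++⁺ʳ F) (gG r∈G)

  Good-∷ : ∀ {F r} → Good F → Justified F r → Good (r ∷ F)
  Good-∷ gF j (here refl) = Justified-mono there j
  Good-∷ gF j (there r∈F) = Justified-mono there (gF r∈F)

  Good-cons : ∀ {F} h t → Good F → Good (consRow h t ∷ F)
  Good-cons h t gF = Good-∷ gF consR

  Good-[] : Good []
  Good-[] ()

  Derives : ℕ → ℕ → ℕ → Set
  Derives t a y = ∃ λ F → Good F × evalRow t a y ∈ F

  derive : ∀ {F t i a y} → Good F → At P t i → Just F t a y i → Derives t a y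
  derive gF at j = _ , Good-∷ gF (evalR at j) , here refl

  proj-rows : ∀ {n} (xs : Vec ℕ n) (i : Fin n) → ∃ λ F → Good F × ProjJ F (toℕ i) (codeList xs) (lookup xs i)
  proj-rows (x ∷ xs) fzero    = _ , Good-cons x (codeList xs) Good-[] , _ , here refl
  proj-rows (x ∷ xs) (fsuc i) with proj-rows xs i
  ... | F , gF , j = _ , Good-cons x (codeList xs) gF , _ , _ , here refl , ProjJ-mono there (toℕ i) j

  below-rows : ∀ u a n → (∀ z → z < n → ∃ λ v → Derives u (pair z a) (suc v)) →
               ∃ λ F → Good F × BelowJ F u a n
  below-rows u a zero    h = [] , Good-[] , λ _ ()
  below-rows u a (suc n) h with below-rows u a n (λ z z<n → h z (m<n⇒m<1+n z<n)) | h n ≤-refl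
  ... | F , gF , below | v , G , gG , r = consRow n a ∷ G ++ F , Good-cons n a (Good-++ gG gF) , both
    where
    both : BelowJ (consRow n a ∷ G ++ F) u a (suc n)
    both z z<1+n with m<1+n⇒m<n∨m≡n z<1+n
    ... | inj₂ refl = pair n a , v , here refl , there (∈-++⁺ˡ r)
    ... | inj₁ z<n = let a₁ , v₁ , c₁ , r₁ = below z z<n
                     in a₁ , v₁ , there (∈-++⁺ʳ G c₁) , there (∈-++⁺ʳ G r₁)

  mutual
    complete : ∀ {n t y} {f : PR n} {xs} → Implements P t f → f ⟦ xs ⟧⇓ y → Derives t (codeList xs) y
    complete (zeroM at) zero⇓ = derive Good-[] at (zeroJ refl)
    complete (succM at) (succ⇓ {x}) = derive (Good-cons x 0 Good-[]) at (succJ (here refl) refl)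
    complete {xs = xs} (projM {i = i} at) proj⇓ with proj-rows xs i
    ... | F , gF , j = derive gF at (projJ j)
    complete (compM {us = us} at mf mg) (comp⇓ ds d) with complete* mg ds | complete mf d
    ... | F , gF , j | G , gG , r =
      derive (Good-++ gF gG) at (compJ (∈-++⁺ʳ F r) (ArgsJ-mono ∈-++⁺ˡ us j))
    complete {xs = _ ∷ xs} (precM at mf mg) (prec0⇓ d) with complete mf d
    ... | F , gF , r = derive (Good-cons 0 (codeList xs) gF) at (prec₀J (here refl) (there r))
    complete {xs = _ ∷ xs} (precM at mf mg) (precS⇓ {x = x} {r = r} d e) with complete (precM at mf mg) d | complete mg e
    ... | F , gF , r₁ | G , gG , r₂ =
      derive (Good-cons (suc x) a (Good-cons x a (Good-cons r a (Good-cons x (pair r a) (Good-++ gF gG))))) at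
        (precₛJ (here refl) (there (here refl)) (there (there (there (there (∈-++⁺ˡ r₁)))))
          (there (there (here refl))) (there (there (there (here refl)))) (there (there (there (there (∈-++⁺ʳ F r₂))))))
      where a = codeList xs
    complete {xs = xs} (muM {u = u} at mf) (mu⇓ {y = y} d below)
      with complete mf d
         | below-rows u (codeList xs) y (λ z z<y → proj₁ (below z z<y) , complete mf (proj₂ (below z z<y)))
    ... | F , gF , r | G , gG , b = derive (Good-cons y (codeList xs) (Good-++ gF gG)) at
      (muJ (here refl) (there (∈-++⁺ˡ r))
        λ z z<y → let a₁ , v , c₁ , r₁ = b z z<y in a₁ , v , there (∈-++⁺ʳ F c₁) , there (∈-++⁺ʳ F r₁))

    complete* : ∀ {m n us} {gs : Vec (PR n) m} {xs ys} → Implements* P us gs → gs ⟦ xs ⟧⇓* ys →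
                ∃ λ F → Good F × ArgsJ F us (codeList xs) (codeList ys)
    complete* []M []⇓ = [] , Good-[] , tt
    complete* {ys = y ∷ ys} (_∷M_ {ts = ts} m ms) (d ∷⇓ ds) with complete m d | complete* ms ds
    ... | F , gF , r | G , gG , j = consRow y (codeList ys) ∷ F ++ G , Good-cons y _ (Good-++ gF gG) ,
      y , codeList ys , here refl , there (∈-++⁺ˡ r) , ArgsJ-mono (there ∘ ∈-++⁺ʳ F) ts j

module _ {P : Program} {T : ℕ → ℕ → ℕ → ℕ → Set} {B : ℕ} {F : List TableRow} where

  open Query⟦⟧ T B
  open Completeness P

  Small : TableRow → Set
  Small (_ , a , b , c) = a ≤ B × b ≤ B × c ≤ B

  Holds : TableRow → Set
  Holds (t , a , b , c) = T t a b c

  -- Closedness speaks about all rows of a table; hence the rows of F must be present and accidental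
  -- further rows must be absent.
  module Satisfaction (F⇒T : ∀ {r} → r ∈ F → Small r × Holds r)
                      (T⇒F : ∀ {t a b c} → t < 2 + length P → Small (t , a , b , c) → T t a b c → (t , a , b , c) ∈ F)
                      (good : Good F) where

    projQ-holds : ∀ {d} {σ : Fin d → ℕ} i a y → ProjJ F i (σ a) (σ y) → ⟦ projQ i a y ⟧ σ
    projQ-holds zero a y (t , r) = let (_ , _ , t≤) , h = F⇒T r in t , t≤ , h
    projQ-holds {σ = σ} (suc i) a y (x , t , r , j) =
      let (_ , x≤ , t≤) , h = F⇒T r
      in x , x≤ , t , t≤ , h , projQ-holds {σ = t ∷ᶠ (x ∷ᶠ σ)} i 0F (2 ↑ʳ y) j

    argsQ-holds : ∀ {d} {σ : Fin d → ℕ} ts a b → ArgsJ F ts (σ a) (σ b) → ⟦ argsQ ts a b ⟧ σ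
    argsQ-holds []       a b _ = refl
    argsQ-holds {σ = σ} (t ∷ ts) a b (z , b′ , c , r , j) =
      let (_ , z≤ , b′≤) , h = F⇒T c
      in z , z≤ , b′ , b′≤ , h , proj₂ (F⇒T r) , argsQ-holds {σ = b′ ∷ᶠ (z ∷ᶠ σ)} ts (2 ↑ʳ a) 0F j

    justQ-holds : ∀ {d} {σ : Fin d → ℕ} t i a y → Just F t (σ a) (σ y) i → ⟦ justQ t i a y ⟧ σ
    justQ-holds t zeroI a y (zeroJ e) = e
    justQ-holds t succI a y (succJ r e) = let (_ , x≤ , b≤) , h = F⇒T r in _ , x≤ , _ , b≤ , h , e
    justQ-holds t (projI i) a y (projJ j) = projQ-holds i a y j
    justQ-holds {σ = σ} t (compI u us) a y (compJ {b = b} r j) =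
      let (b≤ , _) , h = F⇒T r
      in b , b≤ , h , argsQ-holds {σ = b ∷ᶠ σ} us (1 ↑ʳ a) 0F j
    justQ-holds t (precI u v) a y (prec₀J c r) =
      let (_ , z≤ , b≤) , h = F⇒T c
      in λ (no₀ , _) → no₀ (_ , z≤ , _ , b≤ , h , refl , proj₂ (F⇒T r))
    justQ-holds t (precI u v) a y (precₛJ c₀ c₁ r c₂ c₃ s) =
      let (_ , sx≤ , b≤) , h₀ = F⇒T c₀
          (a₁≤ , x≤ , _) , h₁ = F⇒T c₁
          (b₁≤ , r≤ , _) , h₂ = F⇒T c₂
          (a₂≤ , _) , h₃ = F⇒T c₃
      in λ (_ , noₛ) → noₛ (_ , sx≤ , _ , b≤ , _ , x≤ , _ , r≤ , _ , a₁≤ , _ , b₁≤ , _ , a₂≤ ,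
           h₀ , refl , h₁ , proj₂ (F⇒T r) , h₂ , h₃ , proj₂ (F⇒T s))
    justQ-holds t (muI u) a y (muJ c r below) =
      let (a₀≤ , _) , h = F⇒T c
          (_ , 0≤ , _) , k = F⇒T r
      in (_ , a₀≤ , 0 , 0≤ , h , refl , k) ,
         λ { (z , z≤ , z<y , none) →
             let a₁ , v , c₁ , r₁ = below z z<y
                 (a₁≤ , _) , h₁ = F⇒T c₁
                 (_ , v≤ , _) , k₁ = F⇒T r₁
             in none (a₁ , a₁≤ , suc v , v≤ , h₁ , k₁ , λ ()) }

    closed : ∀ {d} {σ : Fin d → ℕ} → ⟦ closedQ P ⟧ σ
    closed {σ = σ} = functional , entries-all {σ = σ} 0 P entry
      where
      functional : ⟦ consQ ⟧ σ
      functional (i , i≤ , h , h≤ , t , t≤ , h′ , h′≤ , t′ , t′≤ , r , r′ , ne)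
        with good (T⇒F (s≤s (s≤s z≤n)) (i≤ , h≤ , t≤) r) | good (T⇒F (s≤s (s≤s z≤n)) (i≤ , h′≤ , t′≤) r′)
      ... | j | j′ = ne (pair-injective (trans (sym (coded j)) (coded j′)))
        where
        coded : ∀ {h t} → Justified F (1 , i , h , t) → i ≡ pair h t
        coded consR = refl
      entry : ∀ {t i} → At P t i → ⟦ entryQ t i ⟧ σ
      entry {t} {i} at (a , a≤ , y , y≤ , r , unjust)
        with good (T⇒F (s≤s (s≤s (At-< at))) (a≤ , y≤ , y≤) r)
      ... | evalR at′ j with At-unique at at′
      ... | refl = unjust (justQ-holds {σ = y ∷ᶠ (a ∷ᶠ σ)} t i 1F 0F j)

-- Closed tables inside the structure

flatten : ℕ → List TableRow → List ℕ
flatten N []                    = []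
flatten N ((t , a , b , c) ∷ F) = t ∷ N + a ∷ N + b ∷ N + c ∷ flatten N F

flatten-row : ∀ N {F t a b c} → (t , a , b , c) ∈ F →
              ∃₂ λ pre post → flatten N F ≡ pre ++ (t ∷ N + a ∷ N + b ∷ N + c ∷ []) ++ post
flatten-row N {_ ∷ F} (here refl) = [] , flatten N F , refl
flatten-row N {(t , a , b , c) ∷ F} (there r∈F) =
  let pre , post , e = flatten-row N r∈F
  in t ∷ N + a ∷ N + b ∷ N + c ∷ pre , post , cong (λ ss → t ∷ N + a ∷ N + b ∷ N + c ∷ ss) e

-- Tags are below N and data are at least N, so a window starting with a tag is a row.
row-flatten : ∀ N F {t a b c} pre post → t < N →
              flatten N F ≡ pre ++ (t ∷ N + a ∷ N + b ∷ N + c ∷ []) ++ post → (t , a , b , c) ∈ F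
row-flatten N [] [] post t<N ()
row-flatten N [] (_ ∷ _) post t<N ()
row-flatten N ((t , a , b , c) ∷ F) [] post t<N e with ∷-injective e
... | refl , e₁ with ∷-injective e₁
... | a≡ , e₂ with ∷-injective e₂
... | b≡ , e₃ with ∷-injective e₃
... | c≡ , _ with +-cancelˡ-≡ N _ _ a≡ | +-cancelˡ-≡ N _ _ b≡ | +-cancelˡ-≡ N _ _ c≡
... | refl | refl | refl = here refl
row-flatten N ((_ , a , _ , _) ∷ F) (_ ∷ []) post t<N e =
  ⊥-elim (m+n≮m N a (subst (_< N) (sym (proj₁ (∷-injective (proj₂ (∷-injective e))))) t<N))
row-flatten N ((_ , _ , b , _) ∷ F) (_ ∷ _ ∷ []) post t<N e =
  ⊥-elim (m+n≮m N b (subst (_< N) (sym (proj₁ (∷-injective (proj₂ (∷-injective (proj₂ (∷-injective e))))))) t<N))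
row-flatten N ((_ , _ , _ , c) ∷ F) (_ ∷ _ ∷ _ ∷ []) post t<N e =
  ⊥-elim (m+n≮m N c (subst (_< N) (sym (proj₁ (∷-injective (proj₂ (∷-injective (proj₂ (∷-injective (proj₂ (∷-injective e))))))))) t<N))
row-flatten N (_ ∷ F) (_ ∷ _ ∷ _ ∷ _ ∷ pre) post t<N e =
  there (row-flatten N F pre post t<N
    (proj₂ (∷-injective (proj₂ (∷-injective (proj₂ (∷-injective (proj₂ (∷-injective e)))))))))

bound : List TableRow → ℕ
bound []                    = 0
bound ((_ , a , b , c) ∷ F) = a ⊔ (b ⊔ (c ⊔ bound F))

bound-row : ∀ {F t a b c} → (t , a , b , c) ∈ F → a ≤ bound F × b ≤ bound F × c ≤ bound F
bound-row {(_ , a , b , c) ∷ F} (here refl) =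
  m≤m⊔n a _ , ≤-trans (m≤m⊔n b _) (m≤n⊔m a _) , ≤-trans (m≤m⊔n c _) (≤-trans (m≤n⊔m b _) (m≤n⊔m a _))
bound-row {(_ , a , b , c) ∷ F} (there r∈F) =
  let a≤ , b≤ , c≤ = bound-row r∈F
      up = λ {n} (le : n ≤ bound F) → ≤-trans le (≤-trans (m≤n⊔m c _) (≤-trans (m≤n⊔m b _) (m≤n⊔m a _)))
  in up a≤ , up b≤ , up c≤

flatten-bounds : ∀ N B F → (∀ {t a b c} → (t , a , b , c) ∈ F → (1 ≤ t × t < N) × (a ≤ B × b ≤ B × c ≤ B)) →
                 All (λ s → 1 ≤ s × s ≤ N + B) (flatten N F)
flatten-bounds N B [] h = []
flatten-bounds N B (_ ∷ F) h with h (here refl)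
... | (1≤t , t<N) , (a≤ , b≤ , c≤) =
  (1≤t , ≤-trans (<⇒≤ t<N) (m≤m+n N B)) ∷ datum a≤ ∷ datum b≤ ∷ datum c≤ ∷
  flatten-bounds N B F (λ r∈F → h (there r∈F))
  where
  datum : ∀ {a} → a ≤ B → 1 ≤ N + a × N + a ≤ N + B
  datum a≤ = ≤-trans (≤-trans 1≤t (<⇒≤ t<N)) (m≤m+n N _) , +-monoʳ-≤ N a≤

module Assembly (k ℓ : ℕ) .{{_ : NonZero k}} .{{_ : NonZero ℓ}}
                (1<k : 1 < k) (1<ℓ : 1 < ℓ) (indep : MultIndep k ℓ) (P : Program) where

  -- The tags are 1 and 2 + t for t < length P. They avoid 0 because digits are positive.
  N : ℕ
  N = 2 + length P

  open Realisation k ℓ 1<k 1<ℓ indep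
  open Windows k ℓ 1<k 1<ℓ indep N
  open Translation k ℓ 1<k N
  open Completeness P

  good-tags : ∀ {F t a b c} → Good F → (t , a , b , c) ∈ F → 1 ≤ t × t < N
  good-tags gF r∈F = tags (gF r∈F)
    where
    tags : ∀ {F t a b c} → Justified F (t , a , b , c) → 1 ≤ t × t < N
    tags consR        = s≤s z≤n , s≤s (s≤s z≤n)
    tags (evalR at _) = s≤s z≤n , s≤s (s≤s (At-< at))

  record Realised (F : List TableRow) : Set where
    field
      p lo hi : ℕ
      N≤p     : N ≤ p
    open Number p N≤p lo hi
    field
      bounded : bound F ≤ B
      sat     : ∀ {d} {σ : Fin d → ℕ} → Query⟦⟧.⟦_⟧ Table B (closedQ P) σ
      present : ∀ {t a b c} → (t , a , b , c) ∈ F → Table t a b c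

  -- With lo and hi at the two ends of the chain, the marks in [lo, hi] are exactly those of the
  -- chain. A window of four marks is then an infix of `flatten N F`, and one that begins with a tag
  -- is a row of F.
  realise-table : ∀ {r} F → Good (r ∷ F) → Realised (r ∷ F)
  realise-table r@{t₀ , _} F₀ gF = record
    { p = p ; lo = lo ; hi = hi ; N≤p = N≤p ; bounded = bound≤B
    ; sat = λ {_} {σ} → Satisfaction.closed (λ {r} r∈F → small r∈F , present r∈F) absent gF {σ = σ}
    ; present = present }
    where
    F = r ∷ F₀
    S = N + bound F
    realised : ∃₂ λ p q → S ≤ p × Digit p t₀ (p + 2) (q + 0) × Chain p (p + 2) (flatten N F)
    -- The start 2 is the least that `realise` admits; the exponent 0 of ℓ is arbitrary.
    realised = realise S t₀ _ (flatten-bounds N (bound F) F λ r∈F → good-tags gF r∈F , bound-row r∈F) 2 0 ≤-refl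
    p = proj₁ realised
    S≤p : S ≤ p
    S≤p = proj₁ (proj₂ (proj₂ realised))
    N≤p : N ≤ p
    N≤p = ≤-trans (m≤m+n N (bound F)) S≤p
    chain : Chain p (p + 2) (flatten N F)
    chain = proj₂ (proj₂ (proj₂ (proj₂ realised)))
    lo = k ^ (p + 2)
    hi = k ^ last chain
    open Number p N≤p lo hi
    bound≤B : bound F ≤ B
    bound≤B = m+n≤o⇒m≤o∸n (bound F) (≤-trans (≤-reflexive (+-comm (bound F) N)) S≤p)
    small : ∀ {t a b c} → (t , a , b , c) ∈ F → a ≤ B × b ≤ B × c ≤ B
    small r∈F = let a≤ , b≤ , c≤ = bound-row r∈F
                in ≤-trans a≤ bound≤B , ≤-trans b≤ bound≤B , ≤-trans c≤ bound≤B
    rep≡ : ∀ n → k ^ (p ∸ (N + n)) ≡ rep n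
    rep≡ n = cong (k ^_) (sym (∸-+-assoc p N n))
    tag-scale : ∀ {t} → t < N → k ^ t * k ^ (p ∸ t) ≡ w
    tag-scale {t} t<N = trans (sym (^-distribˡ-+-* k t (p ∸ t))) (cong (k ^_) (m+[n∸m]≡n (≤-trans (<⇒≤ t<N) N≤p)))
    present : ∀ {t a b c} → (t , a , b , c) ∈ F → Table t a b c
    present {t} {a} {b} {c} r∈F =
      let pre , post , e = flatten-row N r∈F
          v , d , low , high = sub-chain pre t (N + a ∷ N + b ∷ N + c ∷ []) post (subst (Chain p (p + 2)) e chain)
          window = chain⇒row ≤-refl d low (≤-trans high (≤-reflexive (last-subst e)))
      in k ^ (p ∸ t) , tag-scale (proj₂ (good-tags gF r∈F)) ,
         subst (Row w lo hi _ _ _) (rep≡ c)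
           (subst (λ x → Row w lo hi _ _ x _) (rep≡ b) (subst (λ x → Row w lo hi _ x _ _) (rep≡ a) window))
      where
      last-subst : ∀ {ss} (e : flatten N F ≡ ss) → last (subst (Chain p (p + 2)) e chain) ≡ last chain
      last-subst refl = refl
    absent : ∀ {t a b c} → t < N → a ≤ B × b ≤ B × c ≤ B → Table t a b c → (t , a , b , c) ∈ F
    absent {t} {a} {b} {c} t<N (a≤ , b≤ , c≤) (z , scale , window) =
      let v , d , low , high = row⇒chain ≤-refl {t} {N + a} {N + b} {N + c}
            (≤-trans (<⇒≤ t<N) N≤p) (datum≤ a≤) (datum≤ b≤) (datum≤ c≤)
            (subst (Row w lo hi _ _ _) (sym (rep≡ c)) (subst (λ x → Row w lo hi _ _ x _) (sym (rep≡ b))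
              (subst (λ x → Row w lo hi _ x _ _) (sym (rep≡ a)) (subst (λ x → Row w lo hi x _ _ _) z≡ window))))
          pre , post , e = infix-of chain d low high
      in row-flatten N F pre post t<N e
      where
      datum≤ : ∀ {n} → n ≤ B → N + n ≤ p
      datum≤ n≤ = ≤-trans (+-monoʳ-≤ N n≤) (≤-reflexive (m+[n∸m]≡n N≤p))
      z≡ : z ≡ k ^ (p ∸ t)
      z≡ = *-cancelˡ-≡ _ _ (k ^ t) {{m^n≢0 k t}} (trans scale (sym (tag-scale t<N)))

  module _ {D : PR 1} {t : ℕ} (impl : Implements P t D) where

    zeroQuery : Query 1
    zeroQuery = andQ (closedQ P) (exQ (exQ (exQ (andQ (row 1 2F 3F 1F) (andQ (zeroQ 0F) (row (2 + t) 2F 0F 0F))))))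

    -- With x = var 0 and w = var 1, states D ⟦ n ∷ [] ⟧⇓ 0 for the n with k^n x = w;
    -- the inner variables 0, 1, 2, 3 hold the number n, a copy of w, lo and hi.
    zeroFormula : Formula
    zeroFormula = ex (ex (ex (ex (conj (eq (var 1) (var 5)) (conj (P₁ (var 1)) (conj (numF 1 0)
      (conj (scaleF N 0 4) (translate zeroQuery))))))))

    -- The formula may have found a table unrelated to any computation. Closedness together with the
    -- convergence of D at n still forces the recorded value 0 to be the true one.
    zero-sound : ∀ {ρ w x n y} → k ^ n * x ≡ w → Sat k ℓ (x ∷ₑ (w ∷ₑ ρ)) zeroFormula →
                 D ⟦ n ∷ [] ⟧⇓ y → 0 ≡ y
    zero-sound {ρ} {_} {x} {n} scale (hi , lo , _ , m , refl , (p , refl) , (pow@(r , refl) , z , s , le) , s′ , query) der =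
      conclude (number pow Nm≤w)
      where
      env : Env
      env = m ∷ₑ ((k ^ p) ∷ₑ (lo ∷ₑ (hi ∷ₑ (x ∷ₑ ((k ^ p) ∷ₑ ρ)))))
      Nm≤w′ : k ^ N * m ≤ k ^ p
      Nm≤w′ = ≤-trans (≤-reflexive (scale⇒ {z ∷ₑ env} N 1 {0} s)) (LE⇒≤ le)
      N≤p : N ≤ p
      N≤p = ≮⇒≥ λ p<N → <⇒≱ (^-monoʳ-< k 1<k p<N) (≤-trans (m≤m*n (k ^ N) m {{m^n≢0 k r}}) Nm≤w′)
      open Number p N≤p lo hi
      open Query⟦⟧ Table B
      Nm≤w : k ^ N * m ≤ w
      Nm≤w = Nm≤w′
      conclude : (∃ λ n′ → n′ ≤ B × rep n′ ≡ m) → 0 ≡ _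
      conclude (n′ , n′≤B , rep≡m) =
        let closed , (a , a≤ , b , b≤ , y₀ , y₀≤ , c , y₀≡0 , r₀) = Equivalence.to (translate-correct zeroQuery represents) query
        in trans (sym y₀≡0) (Soundness.sound {σ = σ} closed impl der (n≤B , b , b≤ , subst (λ i → Table 1 a i b) (sym n≡n′) c , tt) a≤ y₀≤ r₀)
        where
        σ : Fin 1 → ℕ
        σ = n′ ∷ᶠ λ ()
        represents : Represents env σ
        represents = record { w-eq = refl ; lo-eq = refl ; hi-eq = refl
                            ; reps = λ { fzero → sym rep≡m } ; small = λ { fzero → n′≤B } }
        n≡n′ : n ≡ n′
        n≡n′ = rep-unscale n′≤B (begin-equality
          k ^ (N + n) * rep n′      ≡⟨ cong (_* rep n′) (trans (cong (k ^_) (+-comm N n)) (^-distribˡ-+-* k n N)) ⟩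
          k ^ n * k ^ N * rep n′    ≡⟨ *-assoc (k ^ n) (k ^ N) (rep n′) ⟩
          k ^ n * (k ^ N * rep n′)  ≡⟨ cong (λ u → k ^ n * (k ^ N * u)) rep≡m ⟩
          k ^ n * (k ^ N * m)       ≡⟨ cong (k ^ n *_) (scale⇒ {env} N 0 {4} s′) ⟩
          k ^ n * x                 ≡⟨ scale ⟩
          w                         ∎)
        n≤B : n ≤ B
        n≤B = subst (_≤ B) (sym n≡n′) n′≤B

    zero-complete : ∀ {n} → D ⟦ n ∷ [] ⟧⇓ 0 →
                    ∃₂ λ w x → k ^ n * x ≡ w × ∀ ρ → Sat k ℓ (x ∷ₑ (w ∷ₑ ρ)) zeroFormula
    zero-complete {n} der with complete impl der
    ... | F , gF , r∈F = w , k ^ N * rep n , scaled , λ ρ → hi , lo , w , rep n , refl , (p , refl) ,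
          ((B ∸ n , refl) , k ^ N * rep n , scale⇐ {(k ^ N * rep n) ∷ₑ env ρ} N 1 {0} refl , ≤⇒LE Nm≤w) ,
          scale⇐ {env ρ} N 0 {4} refl , Equivalence.from (translate-correct zeroQuery (represents ρ)) query
      where
      -- The row decoding the argument list is added by hand, since the table of a derivation that
      -- never reads its argument does not contain it.
      open Realised (realise-table {consRow n 0} F (Good-cons n 0 gF))
      open Number p N≤p lo hi
      open Query⟦⟧ Table B
      small : ∀ {t a b c} → (t , a , b , c) ∈ (consRow n 0 ∷ F) → a ≤ B × b ≤ B × c ≤ B
      small r∈ = let a≤ , b≤ , c≤ = bound-row r∈
                 in ≤-trans a≤ bounded , ≤-trans b≤ bounded , ≤-trans c≤ bounded
      n≤B : n ≤ B
      n≤B = proj₁ (proj₂ (small (here refl)))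
      σ : Fin 1 → ℕ
      σ = n ∷ᶠ λ ()
      env : Env → Env
      env ρ = rep n ∷ₑ (w ∷ₑ (lo ∷ₑ (hi ∷ₑ ((k ^ N * rep n) ∷ₑ (w ∷ₑ ρ)))))
      represents : ∀ ρ → Represents (env ρ) σ
      represents ρ = record { w-eq = refl ; lo-eq = refl ; hi-eq = refl
                            ; reps = λ { fzero → refl } ; small = λ { fzero → n≤B } }
      query : ⟦ zeroQuery ⟧ σ
      query = sat {σ = σ} , pair n 0 , proj₁ (small (here refl)) , 0 , z≤n , 0 , z≤n ,
        present (here refl) , refl , present (there r∈F)
      scaled : k ^ n * (k ^ N * rep n) ≡ w
      scaled = trans (sym (*-assoc (k ^ n) (k ^ N) (rep n)))
        (trans (cong (_* rep n) (trans (sym (^-distribˡ-+-* k n N)) (cong (k ^_) (+-comm n N)))) (rep-scale n≤B))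
      Nm≤w : k ^ N * rep n ≤ w
      Nm≤w = ≤-trans (*-monoˡ-≤ (rep n) (^-monoʳ-≤ k (m≤m+n N n))) (≤-reflexive (rep-scale n≤B))

-- Self-application

tri-≥ : ∀ n → n ≤ tri n
tri-≥ zero    = z≤n
tri-≥ (suc n) = m≤m+n (suc n) (tri n)

a≤pair : ∀ a b → a ≤ pair a b
a≤pair a b = ≤-trans (m≤m+n a b) (≤-trans (tri-≥ (a + b)) (m≤m+n _ b))

b≤pair : ∀ a b → b ≤ pair a b
b≤pair a b = m≤n+m b (tri (a + b))

TermBounded-mono : ∀ {m n} → m ≤ n → ∀ t → TermBounded m t → TermBounded n t
TermBounded-mono m≤n (var i)    b       = ≤-trans b m≤n
TermBounded-mono m≤n (plus s t) (b , c) = TermBounded-mono m≤n s b , TermBounded-mono m≤n t c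

Bounded-mono : ∀ {m n} → m ≤ n → ∀ φ → Bounded m φ → Bounded n φ
Bounded-mono m≤n (eq s t)   (b , c) = TermBounded-mono m≤n s b , TermBounded-mono m≤n t c
Bounded-mono m≤n (P₁ t)     b       = TermBounded-mono m≤n t b
Bounded-mono m≤n (P₂ t)     b       = TermBounded-mono m≤n t b
Bounded-mono m≤n (neg φ)    b       = Bounded-mono m≤n φ b
Bounded-mono m≤n (conj φ ψ) (b , c) = Bounded-mono m≤n φ b , Bounded-mono m≤n ψ c
Bounded-mono m≤n (ex φ)     b       = Bounded-mono (s≤s m≤n) φ b

TermBounded-code : ∀ {n} t → codeT t < n → TermBounded n t
TermBounded-code (var i)    lt = ≤-<-trans (b≤pair 0 i) lt
TermBounded-code (plus s t) lt =
  TermBounded-code s (≤-<-trans (≤-trans (a≤pair (codeT s) (codeT t)) (b≤pair 1 _)) lt) ,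
  TermBounded-code t (≤-<-trans (≤-trans (b≤pair (codeT s) (codeT t)) (b≤pair 1 _)) lt)

Bounded-code : ∀ {n} φ → code φ < n → Bounded n φ
Bounded-code (eq s t)   lt =
  TermBounded-code s (≤-<-trans (≤-trans (a≤pair (codeT s) (codeT t)) (b≤pair 0 _)) lt) ,
  TermBounded-code t (≤-<-trans (≤-trans (b≤pair (codeT s) (codeT t)) (b≤pair 0 _)) lt)
Bounded-code (P₁ t)     lt = TermBounded-code t (≤-<-trans (b≤pair 1 _) lt)
Bounded-code (P₂ t)     lt = TermBounded-code t (≤-<-trans (b≤pair 2 _) lt)
Bounded-code (neg φ)    lt = Bounded-code φ (≤-<-trans (b≤pair 3 _) lt)
Bounded-code (conj φ ψ) lt =
  Bounded-code φ (≤-<-trans (≤-trans (a≤pair (code φ) (code ψ)) (b≤pair 4 _)) lt) ,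
  Bounded-code ψ (≤-<-trans (≤-trans (b≤pair (code φ) (code ψ)) (b≤pair 4 _)) lt)
Bounded-code (ex φ)     lt = Bounded-code φ (m<n⇒m<1+n (≤-<-trans (b≤pair 5 _) lt))

exs : ℕ → Formula → Formula
exs zero    φ = φ
exs (suc n) φ = ex (exs n φ)

exs-bounded : ∀ n {m} φ → Bounded (n + m) φ → Bounded m (exs n φ)
exs-bounded zero    φ b = b
exs-bounded (suc n) φ b = exs-bounded n φ (subst (λ m → Bounded m φ) (sym (+-suc n _)) b)

exs-elim : ∀ {k ℓ} n {φ ρ} → Sat k ℓ ρ (exs n φ) → ∃ λ ρ′ → Sat k ℓ ρ′ φ
exs-elim zero    h       = _ , h
exs-elim (suc n) (_ , h) = exs-elim n h

exs-intro : ∀ {k ℓ} n {φ ρ} → (∀ ρ → Sat k ℓ ρ φ) → Sat k ℓ ρ (exs n φ)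
exs-intro zero    h = h _
exs-intro (suc n) h = 0 , exs-intro n h

-- Recursive functions on codes of formulas

constP : ∀ {n} → ℕ → PR n
constP zero    = zeroF
constP (suc m) = comp succF (constP m ∷ [])

constP⇓ : ∀ {n} m {xs : Vec ℕ n} → constP m ⟦ xs ⟧⇓ m
constP⇓ zero    = zero⇓
constP⇓ (suc m) = comp⇓ (constP⇓ m ∷⇓ []⇓) succ⇓

addP : PR 2
addP = prec (proj 0F) (comp succF (proj 1F ∷ []))

addP⇓ : ∀ m n → addP ⟦ m ∷ n ∷ [] ⟧⇓ (m + n)
addP⇓ zero    n = prec0⇓ proj⇓
addP⇓ (suc m) n = precS⇓ (addP⇓ m n) (comp⇓ (proj⇓ ∷⇓ []⇓) succ⇓)

triP : PR 1
triP = prec zeroF (comp addP (comp succF (proj 0F ∷ []) ∷ proj 1F ∷ []))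

triP⇓ : ∀ n → triP ⟦ n ∷ [] ⟧⇓ tri n
triP⇓ zero    = prec0⇓ zero⇓
triP⇓ (suc n) = precS⇓ (triP⇓ n)
  (comp⇓ (comp⇓ (proj⇓ ∷⇓ []⇓) succ⇓ ∷⇓ (proj⇓ ∷⇓ []⇓)) (addP⇓ (suc n) (tri n)))

pairP : ∀ {n} → PR n → PR n → PR n
pairP f g = comp addP (comp triP (comp addP (f ∷ g ∷ []) ∷ []) ∷ g ∷ [])

pairP⇓ : ∀ {n} {f g : PR n} {xs a b} → f ⟦ xs ⟧⇓ a → g ⟦ xs ⟧⇓ b → pairP f g ⟦ xs ⟧⇓ pair a b
pairP⇓ {a = a} {b} df dg = comp⇓
  (comp⇓ (comp⇓ (df ∷⇓ (dg ∷⇓ []⇓)) (addP⇓ a b) ∷⇓ []⇓) (triP⇓ (a + b)) ∷⇓ (dg ∷⇓ []⇓))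
  (addP⇓ (tri (a + b)) b)

exsP : PR 2
exsP = prec (proj 0F) (pairP (constP 5) (proj 1F))

exsP⇓ : ∀ n φ → exsP ⟦ n ∷ code φ ∷ [] ⟧⇓ code (exs n φ)
exsP⇓ zero    φ = prec0⇓ proj⇓
exsP⇓ (suc n) φ = precS⇓ (exsP⇓ n φ) (pairP⇓ (constP⇓ 5) proj⇓)

mulP : ℕ → PR 2
mulP zero    = proj 1F
mulP (suc m) = pairP (constP 1) (pairP (proj 1F) (mulP m))

mulP⇓ : ∀ m {x} t → mulP m ⟦ x ∷ codeT t ∷ [] ⟧⇓ codeT (mulT m t)
mulP⇓ zero    t = proj⇓
mulP⇓ (suc m) t = pairP⇓ (constP⇓ 1) (pairP⇓ proj⇓ (mulP⇓ m t))

module Diagonal (k ℓ : ℕ) .{{_ : NonZero k}} where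

  open Scaling k ℓ

  scaleP : PR 1
  scaleP = prec (constP (codeT (var 0))) (mulP (pred k))

  scaleP⇓ : ∀ n → scaleP ⟦ n ∷ [] ⟧⇓ codeT (scaleT n (var 0))
  scaleP⇓ zero    = prec0⇓ (constP⇓ _)
  scaleP⇓ (suc n) = precS⇓ (scaleP⇓ n) (mulP⇓ (pred k) (scaleT n (var 0)))

  -- A number has no fixed element as its numeral: n is the relation k^n x = w between two
  -- quantified elements, because w must be allowed to grow with the table that φ asks for.
  applied : Formula → ℕ → Formula
  applied φ n = ex (ex (conj (eq (scaleT n (var 0)) (var 1)) φ))

  -- The leading quantifiers close the formula, since a formula has no variable exceeding its code.
  selfApplied : Formula → Formula
  selfApplied φ = exs (suc (code φ)) (applied φ (code φ))

  scaleT-bounded : ∀ {m} n t → TermBounded m t → TermBounded m (scaleT n t)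
  scaleT-bounded zero    t b = b
  scaleT-bounded {m} (suc n) t b = times (pred k)
    where
    times : ∀ j → TermBounded m (mulT j (scaleT n t))
    times zero    = scaleT-bounded n t b
    times (suc j) = scaleT-bounded n t b , times j

  selfApplied-sentence : ∀ φ → Sentence (selfApplied φ)
  selfApplied-sentence φ = exs-bounded (suc (code φ)) (applied φ (code φ))
    ((scaleT-bounded (code φ) (var 0) (s≤s z≤n) , s≤s (s≤s z≤n)) ,
     Bounded-code φ (s≤s (≤-trans (m≤m+n (code φ) 0) (m≤n+m _ 2))))

  selfApplyP : PR 1
  selfApplyP = comp exsP (comp succF (proj 0F ∷ []) ∷
    pairP (constP 5) (pairP (constP 5) (pairP (constP 4)
      (pairP (pairP (constP 0) (pairP scaleP (constP (codeT (var 1))))) (proj 0F)))) ∷ [])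

  selfApplyP⇓ : ∀ φ → selfApplyP ⟦ code φ ∷ [] ⟧⇓ code (selfApplied φ)
  selfApplyP⇓ φ = comp⇓
    (comp⇓ (proj⇓ ∷⇓ []⇓) succ⇓ ∷⇓
     (pairP⇓ (constP⇓ 5) (pairP⇓ (constP⇓ 5) (pairP⇓ (constP⇓ 4)
       (pairP⇓ (pairP⇓ (constP⇓ 0) (pairP⇓ (scaleP⇓ (code φ)) (constP⇓ _))) proj⇓))) ∷⇓ []⇓))
    (exsP⇓ (suc (code φ)) (applied φ (code φ)))

  selfApplied-elim : ∀ φ {ρ} → Sat k ℓ ρ (selfApplied φ) →
                     ∃ λ ρ′ → ∃₂ λ w x → k ^ code φ * x ≡ w × Sat k ℓ (x ∷ₑ (w ∷ₑ ρ′)) φ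
  selfApplied-elim φ h =
    let ρ , w , x , s , h′ = exs-elim (suc (code φ)) {applied φ (code φ)} h
    in ρ , w , x , scale⇒ {x ∷ₑ (w ∷ₑ ρ)} (code φ) 0 {1} s , h′

  selfApplied-intro : ∀ φ {ρ} → (∃₂ λ w x → k ^ code φ * x ≡ w × ∀ ρ → Sat k ℓ (x ∷ₑ (w ∷ₑ ρ)) φ) →
                      Sat k ℓ ρ (selfApplied φ)
  selfApplied-intro φ (w , x , s , h) = exs-intro (suc (code φ)) {applied φ (code φ)}
    λ ρ → w , x , scale⇐ {x ∷ₑ (w ∷ₑ ρ)} (code φ) 0 {1} s , h ρ

  -- Truth of the sentence is refuted first, through acceptance and soundness of `ζ`; its untruth
  -- then brings rejection, and completeness of `ζ` returns its truth. No case distinction on truth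
  -- is made, and `ζ` need be sound only where `c` after `selfApplyP` converges.
  undecidable : (c : PR 1) →
    (∀ φ → Sentence φ → (True k ℓ φ → c ⟦ code φ ∷ [] ⟧⇓ 1) × (¬ True k ℓ φ → c ⟦ code φ ∷ [] ⟧⇓ 0)) →
    (ζ : Formula) →
    (∀ {ρ w x n y} → k ^ n * x ≡ w → Sat k ℓ (x ∷ₑ (w ∷ₑ ρ)) ζ → comp c (selfApplyP ∷ []) ⟦ n ∷ [] ⟧⇓ y → 0 ≡ y) →
    (∀ {n} → comp c (selfApplyP ∷ []) ⟦ n ∷ [] ⟧⇓ 0 →
      ∃₂ λ w x → k ^ n * x ≡ w × ∀ ρ → Sat k ℓ (x ∷ₑ (w ∷ₑ ρ)) ζ) → ⊥
  undecidable c decides ζ ζ-sound ζ-complete =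
    refute (selfApplied ζ) (decides (selfApplied ζ) (selfApplied-sentence ζ))
      (λ d → comp⇓ (selfApplyP⇓ ζ ∷⇓ []⇓) d) (selfApplied-elim ζ) (selfApplied-intro ζ)
    where
    refute : ∀ S {e} → (True k ℓ S → c ⟦ code S ∷ [] ⟧⇓ 1) × (¬ True k ℓ S → c ⟦ code S ∷ [] ⟧⇓ 0) →
             (∀ {y} → c ⟦ code S ∷ [] ⟧⇓ y → comp c (selfApplyP ∷ []) ⟦ e ∷ [] ⟧⇓ y) →
             (True k ℓ S → ∃ λ ρ → ∃₂ λ w x → k ^ e * x ≡ w × Sat k ℓ (x ∷ₑ (w ∷ₑ ρ)) ζ) →
             ((∃₂ λ w x → k ^ e * x ≡ w × ∀ ρ → Sat k ℓ (x ∷ₑ (w ∷ₑ ρ)) ζ) → True k ℓ S) → ⊥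
    refute S {e} (accepts , rejects) computes elim intro = untrue (intro (ζ-complete {e} (computes (rejects untrue))))
      where
      untrue : ¬ True k ℓ S
      untrue h =
        let ρ , w , x , s , h′ = elim h
        in 0≢1+n (ζ-sound {ρ} {w} {x} {e} s h′ (computes (accepts h)))

theoremB : (k ℓ : ℕ) → k ≥ 2 → ℓ ≥ 2 → MultIndep k ℓ → ¬ TheoryDecidable k ℓ
theoremB k ℓ k≥2 ℓ≥2 indep (c , decides) =
  let _ , _ , _ , impl = compile (comp c (selfApplyP ∷ [])) [] in contradictory impl
  where
  instance
    k≢0 : NonZero k
    k≢0 = >-nonZero (≤-trans (s≤s z≤n) k≥2)
    ℓ≢0 : NonZero ℓ
    ℓ≢0 = >-nonZero (≤-trans (s≤s z≤n) ℓ≥2)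
  open Diagonal k ℓ
  contradictory : ∀ {P t} → Implements P t (comp c (selfApplyP ∷ [])) → ⊥
  contradictory {P} {t} impl = undecidable c decides (zeroFormula impl)
    (λ {ρ} {w} {x} {n} → zero-sound impl {ρ} {w} {x} {n}) (λ {n} → zero-complete impl {n})
    where open Assembly k ℓ k≥2 ℓ≥2 indep P
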